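{- (i) Let $G$ be an abelian group of order $9m^4$, where $m$ is a positive odd integer and $\gcd(3,m)=1$. If there exists a $(9m^4, r(3m^2+1), -3m^2+r^2+3r, r^2+r)$ negative Latin square type PDS in $G$ with $r\le \frac{3m^2-1}{2}$, then $$r=\frac{3m^2-3}{4},\; \frac{3m^2+1}{4},\; \frac{3m^2+5}{4},\; \frac{3m^2-5}{2},\; \frac{3m^2-3}{2},\; \text{or } \frac{3m^2-1}{2}.$$ (ii) Furthermore, let $m=p^s$, where $p$ is a prime number with $p\equiv 1 \pmod 4$ and $s$ is an odd positive integer. If there exists a $(9p^{4s}, r(3p^{2s}+1), -3p^{2s}+r^2+3r, r^2+r)$ negative Latin square type PDS in an abelian group $G$ of order $9p^{4s}$ with $r\le \frac{3p^{2s}-1}{2}$, then $$r=\frac{3p^{2s}+1}{4},\; \frac{3p^{2s}-1}{2},\; \text{or } \frac{3p^{2s}-3}{2}.$$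
   Context: A subset $D$ of a finite abelian group $G$ of order $v$ with $|D|=k$ is a $(v,k,\lambda,\mu)$-partial difference set (PDS) if the differences $gh^{ -1}$ ($g,h\in D$, $g\neq h$) represent each non-identity element of $D$ exactly $\lambda$ times and each non-identity element of $G\setminus D$ exactly $\mu$ times. A PDS with parameters $(n^2, r(n+1), -n+r^2+3r, r^2+r)$ is called a negative Latin square type PDS.
   Formalization: The hypothesis r ≥ 1 is added: for r = 0 the empty set satisfies the definition of the PDS (e.g. with m = 5) and the claimed list of values for r fails; only this empty-set case is excluded. -}

module Defs where

open import Data.Nat using (ℕ; _+_; _*_; _^_)
open import Data.Integer as ℤ using (ℤ; +_)
open import Data.Fin using (Fin; _≟_)
open import Data.Fin.Subset using (Subset; _∈_; _∉_; ∣_∣)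
open import Data.Fin.Subset.Properties using (_∈?_)
open import Data.List using (List; length; filter; allFin; concatMap; map)
open import Data.Product using (_×_; _,_)
open import Relation.Nullary using (¬_; ¬?; _×-dec_)
open import Relation.Binary.PropositionalEquality using (_≡_; _≢_)
open import Algebra.Core using (Op₁; Op₂)

allPairs : (v : ℕ) → List (Fin v × Fin v)
allPairs v = concatMap (λ g → map (λ h → (g , h)) (allFin v)) (allFin v)

diffCount : {v : ℕ} → Op₂ (Fin v) → Op₁ (Fin v) → Subset v → Fin v → ℕ
diffCount {v} _∙_ _⁻¹ D x =
  length (filter (λ { (g , h) → (g ∈? D) ×-dec ((h ∈? D) ×-dec (¬? (g ≟ h) ×-dec ((g ∙ (h ⁻¹)) ≟ x))) })
                 (allPairs v))

IsPDS : {v : ℕ} → Op₂ (Fin v) → Fin v → Op₁ (Fin v) →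
        Subset v → ℕ → ℤ → ℤ → Set
IsPDS _∙_ ε _⁻¹ D k lam mu =
  (∣ D ∣ ≡ k) ×
  (∀ x → x ≢ ε →
     (x ∈ D → + diffCount _∙_ _⁻¹ D x ≡ lam) ×
     (x ∉ D → + diffCount _∙_ _⁻¹ D x ≡ mu))

IsNLSPDS : {v : ℕ} → Op₂ (Fin v) → Fin v → Op₁ (Fin v) →
           Subset v → (n r : ℕ) → Set
IsNLSPDS _∙_ ε _⁻¹ D n r =
  IsPDS _∙_ ε _⁻¹ D (r * (n + 1))
        (ℤ.- (+ n) ℤ.+ + (r * r + 3 * r))
        (+ (r * r + r))

{-# OPTIONS --safe #-}
module Submission where

-- Write M = m² (resp. p²ˢ), n = 3M, and let E = D − r·ε in the group ring, so that E² = −nE + μG.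
-- For a prime p ∤ |G|, comparing E^p with its Frobenius image modulo p shows that D is closed under
-- g ↦ g^p; hence D is invariant under the automorphism that inverts the Sylow 3-subgroup N (of order 9)
-- and fixes its complement H.  Modulo 3 the same comparison shows that X(z) = |D ∩ Nz| is divisible by 3
-- for every coset Nz ≠ N, while the automorphism shows that X(z) ≡ |D ∩ H ∩ Nz| (mod 2).  Therefore
-- X(z)² − 6X(z) + 9|D ∩ H ∩ Nz| ≥ 0.  Summed over all cosets other than N, with Σ X² counted by differences
-- lying in N and |D ∩ H| bounded by the same count for H, this forces 2r + 4 > n, and 2r + 2 = n is
-- excluded by parity.  Only the last two values in (i) and in (ii) thus survive.

open import Defs
open import Algebra.Bundles using (CommutativeRing; AbelianGroup; Group)
open import Algebra.Core using (Op₁; Op₂)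
open import Algebra.Structures using (IsAbelianGroup; IsCommutativeRing)
import Algebra.Construct.Pointwise as Pointwise
import Algebra.Properties.Semiring.Mult as SemiringMult
open import Data.Bool using (if_then_else_)
open import Data.Fin as Fin using (Fin; _≟_; fromℕ; inject₁)
open import Data.Fin.Properties as Fin using (toℕ<n; toℕ-fromℕ; toℕ-inject₁)
open import Data.Fin.Permutation using (Permutation′; permutation)
open import Data.Fin.Subset as Subset using (Subset; inside; outside)
open import Data.Fin.Subset.Properties using (_∈?_; drop-there)
open import Data.Integer as ℤ using (ℤ; +_; -[1+_]; 0ℤ; 1ℤ)
import Data.Integer.Properties as ℤ
open import Data.Integer.Divisibility.Signed as ℤ∣ using () renaming (_∣_ to _∣ℤ_)
import Data.Integer.Tactic.RingSolver as ℤ-Solver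
open import Data.List as List using (List; _∷_; []; length; filter; concatMap; tabulate; allFin)
import Data.List.Properties as List
open import Data.List.Relation.Unary.All using (All; _∷_; [])
open import Data.Nat as ℕ using (ℕ; zero; suc; _∸_; _!; s≤s; z≤n; NonZero)
import Data.Nat.Properties as ℕ
open import Data.Nat.Combinatorics using (_C_; nCn≡1; nCk≡n!/k![n-k]!; k![n∸k]!∣n!)
open import Data.Nat.Coprimality as Coprime using (Coprime; coprime?; coprime-Bézout; coprime-divisor)
open import Data.Nat.Divisibility as ℕ∣ using (_∣_; divides; ∣⇒≤)
open import Data.Nat.DivMod using (m/n*n≡m)
open import Data.Nat.GCD using (module Bézout)
open import Data.Nat.ListAction using (product)
open import Data.Nat.Primality using (Prime; prime?; prime[2]; ¬prime[1]; euclidsLemma; prime⇒nonZero; prime⇒nonTrivial; prime⇒irreducible)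
open import Data.Nat.Primality.Factorisation using (factorise; module PrimeFactorisation)
import Data.Nat.Tactic.RingSolver as ℕ-Solver
open import Data.Product as Product using (_,_; ∃; proj₁; proj₂)
open import Data.Sum using (_⊎_; inj₁; inj₂; [_,_]′; reduce)
open import Data.Vec as Vec using ([]; _∷_)
open import Data.Vec.Functional using (Vector)
open import Function using (_∘_; id)
open import Level using (Level; 0ℓ)
open import Relation.Binary using (IsEquivalence; tri<; tri≈; tri>)
open import Relation.Binary.PropositionalEquality as ≡ using (_≡_; _≢_; cong; cong₂; subst; module ≡-Reasoning)
open import Relation.Nullary using (Dec; yes; no; does; ¬_; ¬?; _×-dec_; contradiction)
open import Relation.Nullary.Decidable using (from-yes; from-no)
open import Relation.Unary using (Pred; Decidable)

-- The quadratic X² - 6X + 9F, with F = |D ∩ H ∩ Nz|, vanishes at (X, F) = (0, 0), (6, 0) and (3,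
-- 1). For F = 0 it is negative exactly when 0 < X < 6, so neither congruence suffices alone:
-- divisibility by 3 would admit X = 3, parity would admit X = 2 and X = 4. The coset N is
-- exceptional because E and D differ by r at the identity, so that there only X ≡ r (mod 3) holds;
-- |D ∩ N| therefore stays in the final inequality as a nonnegative unknown. The Sylow 3-subgroup
-- may be cyclic or elementary. The 9th-power map kills it either way, so cosets of N appear
-- throughout as fibres of `pow 9`, cosets of H as fibres of `pow w` with w = M², and each fibre is
-- labelled by the common power of its elements.

prime[3] : Prime 3
prime[3] = from-yes (prime? 3)

-- Additivity of the p-th power in characteristic p

prime-∣! : ∀ {p} → Prime p → ∀ n → p ∣ n ! → p ℕ.≤ n
prime-∣! {p} pr zero    p∣1 = contradiction (∣⇒≤ p∣1) (ℕ.<⇒≱ (ℕ.nonTrivial⇒n>1 p {{prime⇒nonTrivial pr}}))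
prime-∣! pr (suc n) p∣ with euclidsLemma (suc n) (n !) pr p∣
... | inj₁ p∣1+n = ∣⇒≤ p∣1+n
... | inj₂ p∣n!  = ℕ.m≤n⇒m≤1+n (prime-∣! pr n p∣n!)

prime-∣-C : ∀ {p k} → Prime p → 0 ℕ.< k → k ℕ.< p → p ∣ p C k
prime-∣-C {p} {k} pr 0<k k<p = helper
  where
  instance
    _ = prime⇒nonZero pr
    _ = ℕ.m*n≢0 (k !) ((p ∸ k) !) {{k ℕ.!≢0}} {{(p ∸ k) ℕ.!≢0}}

  p!≡ : (p C k) ℕ.* (k ! ℕ.* (p ∸ k) !) ≡ p !
  p!≡ = ≡.trans (cong (ℕ._* (k ! ℕ.* (p ∸ k) !)) (nCk≡n!/k![n-k]! (ℕ.<⇒≤ k<p)))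
                (m/n*n≡m (k![n∸k]!∣n! (ℕ.<⇒≤ k<p)))

  p∣p! : ∀ n → .{{NonZero n}} → n ∣ n !
  p∣p! (suc n) = divides (n !) (ℕ.*-comm (suc n) (n !))

  helper : p ∣ p C k
  helper with euclidsLemma (p C k) (k ! ℕ.* (p ∸ k) !) pr (subst (p ∣_) (≡.sym p!≡) (p∣p! p))
  ... | inj₁ p∣C = p∣C
  ... | inj₂ p∣!! with euclidsLemma (k !) ((p ∸ k) !) pr p∣!!
  ...   | inj₁ p∣k! = contradiction (prime-∣! pr k p∣k!) (ℕ.<⇒≱ k<p)
  ...   | inj₂ p∣   = contradiction (prime-∣! pr (p ∸ k) p∣)
                        (ℕ.<⇒≱ (ℕ.∸-monoʳ-< 0<k (ℕ.<⇒≤ k<p)))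

module PrimeCharacteristic {c ℓ} (R : CommutativeRing c ℓ) {p : ℕ} (p-prime : Prime p)
  (char : ∀ x → CommutativeRing._≈_ R (SemiringMult._×_ (CommutativeRing.semiring R) p x) (CommutativeRing.0# R))
  where

  open CommutativeRing R
  open SemiringMult semiring using (_×_; ×-assocˡ; ×-congʳ)
  open import Algebra.Properties.Semiring.Exp semiring
  open import Algebra.Properties.Semiring.Sum semiring
  open import Algebra.Properties.CommutativeSemiring.Binomial commutativeSemiring
  open import Relation.Binary.Reasoning.Setoid setoid

  ∣-×≈0 : ∀ {n} → p ∣ n → ∀ x → n × x ≈ 0#
  ∣-×≈0 (divides q ≡.refl) x = trans (sym (×-assocˡ x q p))
    (trans (×-congʳ q (char x)) (q×0 q))
    where
    q×0 : ∀ q → q × 0# ≈ 0#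
    q×0 zero    = refl
    q×0 (suc q) = trans (+-identityˡ _) (q×0 q)

  0^p≈0 : 0# ^ p ≈ 0#
  0^p≈0 = go p {{prime⇒nonZero p-prime}}
    where
    go : ∀ n → .{{NonZero n}} → 0# ^ n ≈ 0#
    go (suc n) = zeroˡ _

  -- In the binomial expansion only the two outer terms survive. This serves twice: for the integers
  -- modulo p it yields Fermat's theorem, for the group ring over them the Frobenius map.
  +-^p : ∀ x y → (x + y) ^ p ≈ x ^ p + y ^ p
  +-^p x y = trans (theorem p x y) (expand p ≡.refl {{prime⇒nonZero p-prime}})
    where
    middle : ∀ {q} → suc q ≡ p → ∀ (i : Fin q) →
             binomialTerm x y (suc q) (Fin.suc (inject₁ i)) ≈ 0#
    middle ≡.refl i rewrite toℕ-inject₁ i =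
      ∣-×≈0 (prime-∣-C p-prime (s≤s z≤n) (s≤s (toℕ<n i))) _

    top : ∀ n → binomialTerm x y n (fromℕ n) ≈ x ^ n
    top n rewrite toℕ-fromℕ n | nCn≡1 n | ℕ.n∸n≡0 n = trans (+-identityʳ _) (*-identityʳ _)

    expand : ∀ n → n ≡ p → .{{NonZero n}} → binomialExpansion x y n ≈ x ^ n + y ^ n
    expand (suc q) eq = begin
      binomialTerm x y (suc q) Fin.zero + sum (binomialTerm x y (suc q) ∘ Fin.suc)
        ≈⟨ +-cong (trans (+-identityʳ _) (*-identityˡ _)) (sum-init-last (binomialTerm x y (suc q) ∘ Fin.suc)) ⟩
      y ^ suc q + (sum (λ i → binomialTerm x y (suc q) (Fin.suc (inject₁ i)))
                   + binomialTerm x y (suc q) (fromℕ (suc q)))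
        ≈⟨ +-congˡ (+-cong (trans (sum-cong-≋ (middle eq)) (sum-replicate-zero q)) (top (suc q))) ⟩
      y ^ suc q + (0# + x ^ suc q) ≈⟨ +-congˡ (+-identityˡ _) ⟩
      y ^ suc q + x ^ suc q        ≈⟨ +-comm _ _ ⟩
      x ^ suc q + y ^ suc q        ∎

  sum-^p : ∀ {n} (f : Vector Carrier n) → sum f ^ p ≈ sum (λ i → f i ^ p)
  sum-^p {zero}  f = 0^p≈0
  sum-^p {suc n} f = trans (+-^p _ _) (+-congˡ (sum-^p (f ∘ Fin.suc)))

-- Coprimality and the exponent of the reflecting automorphism

prime-divisor : ∀ n → 1 ℕ.< n → ∃ λ p → Prime p Product.× p ∣ n
prime-divisor n@(suc _) 1<n with factorise n
... | record { factors = [] ; isFactorisation = ≡.refl } = contradiction 1<n (ℕ.<-irrefl ≡.refl)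
... | record { factors = p ∷ ps ; isFactorisation = eq ; factorsPrime = p-prime ∷ _ } =
  p , p-prime , ℕ∣.divides (product ps) (≡.trans eq (ℕ.*-comm p (product ps)))

no-common-prime⇒coprime : ∀ {m n} → .{{NonZero n}} → (∀ {p} → Prime p → p ∣ m → ¬ (p ∣ n)) → Coprime m n
no-common-prime⇒coprime {m} {n} none {d} (d∣m , d∣n) with ℕ.<-cmp 1 d
... | tri≈ _ 1≡d _ = ≡.sym 1≡d
... | tri> _ _ (s≤s z≤n) = contradiction (ℕ∣.0∣⇒≡0 d∣n) (ℕ.≢-nonZero⁻¹ n)
... | tri< 1<d _ _ with prime-divisor d 1<d
...   | p , p-prime , p∣d = contradiction (ℕ∣.∣-trans p∣d d∣n) (none p-prime (ℕ∣.∣-trans p∣d d∣m))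

-- The exponent 1 + aw is ≡ 1 (mod w) and ≡ −1 (mod 9).
reflecting-exponent : ∀ {w} → Coprime 9 w → ∃ λ a → ∃ λ b → 2 ℕ.+ a ℕ.* w ≡ 9 ℕ.* b
reflecting-exponent {w} 9⊥w with coprime-Bézout 9⊥w
... | Bézout.+- x y eq = 2 ℕ.* y , 2 ℕ.* x , ≡.trans (e₁ y w) (≡.trans (cong (2 ℕ.*_) eq) (e₂ x))
  where
  e₁ : ∀ y w → 2 ℕ.+ 2 ℕ.* y ℕ.* w ≡ 2 ℕ.* (1 ℕ.+ y ℕ.* w)
  e₁ = ℕ-Solver.solve-∀
  e₂ : ∀ x → 2 ℕ.* (x ℕ.* 9) ≡ 9 ℕ.* (2 ℕ.* x)
  e₂ = ℕ-Solver.solve-∀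
-- Here y w ≡ 1 (mod 9), so a ≡ -2y is wanted and 7 ≡ -2; in the other case y w ≡ -1 and a = 2y
-- serves.
... | Bézout.-+ x y eq = 7 ℕ.* y , 1 ℕ.+ 7 ℕ.* x ,
  ≡.trans (cong (2 ℕ.+_) (ℕ.*-assoc 7 y w)) (≡.trans (cong (λ t → 2 ℕ.+ 7 ℕ.* t) (≡.sym eq)) (e₁ x))
  where
  e₁ : ∀ x → 2 ℕ.+ 7 ℕ.* (1 ℕ.+ x ℕ.* 9) ≡ 9 ℕ.* (1 ℕ.+ 7 ℕ.* x)
  e₁ = ℕ-Solver.solve-∀

-- Indicators with values in a commutative ring

module Indicator {c ℓ} (R : CommutativeRing c ℓ) where
  open CommutativeRing R
  open import Algebra.Properties.Semiring.Sum semiring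
  open import Relation.Binary.Reasoning.Setoid setoid

  𝟙 : ∀ {a} {P : Set a} → Dec P → Carrier
  𝟙 P? = if does P? then 1# else 0#

  𝟙-cong : ∀ {a b} {P : Set a} {Q : Set b} (P? : Dec P) (Q? : Dec Q) →
           (P → Q) → (Q → P) → 𝟙 P? ≡ 𝟙 Q?
  𝟙-cong (yes p) (yes q) f g = ≡.refl
  𝟙-cong (yes p) (no ¬q) f g = contradiction (f p) ¬q
  𝟙-cong (no ¬p) (yes q) f g = contradiction (g q) ¬p
  𝟙-cong (no ¬p) (no ¬q) f g = ≡.refl

  𝟙-yes : ∀ {a} {P : Set a} (P? : Dec P) → P → 𝟙 P? ≡ 1#
  𝟙-yes (yes _) p = ≡.refl
  𝟙-yes (no ¬p) p = contradiction p ¬p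

  𝟙-no : ∀ {a} {P : Set a} (P? : Dec P) → ¬ P → 𝟙 P? ≡ 0#
  𝟙-no (yes p) ¬p = contradiction p ¬p
  𝟙-no (no _)  ¬p = ≡.refl

  𝟙-guard : ∀ {a} {P : Set a} (P? : Dec P) {x y} → (P → x ≈ y) → 𝟙 P? * x ≈ 𝟙 P? * y
  𝟙-guard (yes p) eq = *-congˡ (eq p)
  𝟙-guard (no _)  eq = trans (zeroˡ _) (sym (zeroˡ _))

  sum-𝟙 : ∀ {n} (a : Fin n) (f : Vector Carrier n) → sum (λ y → 𝟙 (y ≟ a) * f y) ≈ f a
  sum-𝟙 {suc n} Fin.zero f = begin
    1# * f Fin.zero + sum (λ y → 0# * f (Fin.suc y))
      ≈⟨ +-cong (*-identityˡ _) (sum-cong-≋ {n} (λ y → zeroˡ _)) ⟩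
    f Fin.zero + sum {n} (λ _ → 0#) ≈⟨ +-congˡ (sum-replicate-zero n) ⟩
    f Fin.zero + 0#                 ≈⟨ +-identityʳ _ ⟩
    f Fin.zero                      ∎
  sum-𝟙 {suc n} (Fin.suc a) f = begin
    0# * f Fin.zero + sum (λ y → 𝟙 (Fin.suc y ≟ Fin.suc a) * f (Fin.suc y))
      ≈⟨ +-cong (zeroˡ _) (sum-cong-≋ {n} (λ y → *-congʳ (reflexive
           (𝟙-cong (Fin.suc y ≟ Fin.suc a) (y ≟ a) (λ { ≡.refl → ≡.refl }) (cong Fin.suc))))) ⟩
    0# + sum (λ y → 𝟙 (y ≟ a) * f (Fin.suc y)) ≈⟨ +-identityˡ _ ⟩
    sum (λ y → 𝟙 (y ≟ a) * f (Fin.suc y))      ≈⟨ sum-𝟙 a (f ∘ Fin.suc) ⟩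
    f (Fin.suc a)                              ∎

-- Finite abelian groups and their group rings

module FiniteAbelianGroup {v : ℕ} {_∙_ : Op₂ (Fin v)} {ε : Fin v} {_⁻¹ : Op₁ (Fin v)}
  (isAbelianGroup : IsAbelianGroup _≡_ _∙_ ε _⁻¹) where

  abelianGroup : AbelianGroup _ _
  abelianGroup = record { isAbelianGroup = isAbelianGroup }

  open AbelianGroup abelianGroup public
    using (identityˡ; identityʳ; comm; assoc; inverseˡ; inverseʳ; group; commutativeMonoid)
  open Group group public using (_\\_)
  open import Algebra.Properties.Group group public
    using (ε⁻¹≈ε; ⁻¹-injective; //-rightDividesˡ; //-rightDividesʳ; ⁻¹-anti-homo-∙; ⁻¹-anti-homo-\\; inverseˡ-unique; x∙y⁻¹≈ε⇒x≈y; identityˡ-unique; identityʳ-unique; \\-leftDividesˡ; \\-leftDividesʳ)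
  open import Algebra.Properties.CommutativeMonoid.Mult commutativeMonoid public
    using () renaming (_×_ to pow; ×-homo-+ to pow-+; ×-assocˡ to pow-*; ×-distrib-+ to pow-∙)

  \\-∙ : ∀ a b x → (a ∙ b) \\ x ≡ b \\ (a \\ x)
  \\-∙ a b x = ≡.trans (cong (_∙ x) (⁻¹-anti-homo-∙ a b)) (assoc (b ⁻¹) (a ⁻¹) x)

  \\⇒∙ : ∀ {a x b} → a \\ x ≡ b → x ≡ a ∙ b
  \\⇒∙ {a} {x} eq = ≡.trans (≡.sym (\\-leftDividesˡ a x)) (cong (a ∙_) eq)

  ∙⇒\\ : ∀ {a x b} → x ≡ a ∙ b → a \\ x ≡ b
  ∙⇒\\ {a} {x} {b} eq = ≡.trans (cong (a \\_) eq) (\\-leftDividesʳ a b)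

  translation : Fin v → Permutation′ v
  translation a = permutation (a ∙_) (a \\_) (\\-leftDividesˡ a) (\\-leftDividesʳ a)

  involution : (σ : Fin v → Fin v) → (∀ y → σ (σ y) ≡ y) → Permutation′ v
  involution σ σσ = permutation σ σ σσ σσ

  \\-involutive : ∀ x y → (y \\ x) \\ x ≡ y
  \\-involutive x y = ∙⇒\\ (≡.sym (≡.trans (comm (y \\ x) y) (\\-leftDividesˡ y x)))

  module GroupRing {c ℓ} (R : CommutativeRing c ℓ) where
    open CommutativeRing R
    open import Algebra.Properties.Semiring.Sum semiring
    open import Relation.Binary.Reasoning.Setoid setoid
    open Indicator R

    infixl 7 _⊛_

    _⊛_ : Op₂ (Fin v → Carrier)
    (f ⊛ g) x = sum (λ y → f y * g (y \\ x))

    δ : Fin v → Fin v → Carrier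
    δ a y = 𝟙 (y ≟ a)

    ⊛-cong : ∀ {f f′ g g′} → (∀ x → f x ≈ f′ x) → (∀ x → g x ≈ g′ x) → ∀ x → (f ⊛ g) x ≈ (f′ ⊛ g′) x
    ⊛-cong f≈ g≈ x = sum-cong-≋ {v} (λ y → *-cong (f≈ y) (g≈ (y \\ x)))

    ⊛-comm : ∀ f g x → (f ⊛ g) x ≈ (g ⊛ f) x
    ⊛-comm f g x = begin
      sum (λ y → f y * g (y \\ x))
        ≈⟨ ∑-permute _ (involution (_\\ x) (\\-involutive x)) ⟩
      sum (λ y → f (y \\ x) * g ((y \\ x) \\ x))
        ≈⟨ sum-cong-≋ {v} (λ y → trans (*-congˡ (reflexive (cong g (\\-involutive x y)))) (*-comm _ _)) ⟩
      sum (λ y → g y * f (y \\ x)) ∎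

    ⊛-assoc : ∀ f g h x → ((f ⊛ g) ⊛ h) x ≈ (f ⊛ (g ⊛ h)) x
    ⊛-assoc f g h x = begin
      sum (λ y → sum (λ z → f z * g (z \\ y)) * h (y \\ x))
        ≈⟨ sum-cong-≋ {v} (λ y → *-distribʳ-sum (h (y \\ x)) (λ z → f z * g (z \\ y))) ⟩
      sum (λ y → sum (λ z → f z * g (z \\ y) * h (y \\ x)))
        ≈⟨ ∑-comm (λ y z → f z * g (z \\ y) * h (y \\ x)) ⟩
      sum (λ z → sum (λ y → f z * g (z \\ y) * h (y \\ x)))
        ≈⟨ sum-cong-≋ {v} (λ z → ∑-permute (λ y → f z * g (z \\ y) * h (y \\ x)) (translation z)) ⟩
      sum (λ z → sum (λ y → f z * g (z \\ (z ∙ y)) * h ((z ∙ y) \\ x)))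
        ≈⟨ sum-cong-≋ {v} (λ z → sum-cong-≋ {v} (λ y → trans (*-assoc _ _ _)
             (*-congˡ (*-cong (reflexive (cong g (\\-leftDividesʳ z y))) (reflexive (cong h (\\-∙ z y x))))))) ⟩
      sum (λ z → sum (λ y → f z * (g y * h (y \\ (z \\ x)))))
        ≈⟨ sum-cong-≋ {v} (λ z → *-distribˡ-sum (f z) (λ y → g y * h (y \\ (z \\ x)))) ⟨
      sum (λ z → f z * sum (λ y → g y * h (y \\ (z \\ x)))) ∎

    ⊛-identityˡ : ∀ f x → (δ ε ⊛ f) x ≈ f x
    ⊛-identityˡ f x = trans (sum-𝟙 ε (λ y → f (y \\ x)))
      (reflexive (cong f (∙⇒\\ (≡.sym (identityˡ x)))))

    ⊛-distribˡ : ∀ f g h x → (f ⊛ (λ y → g y + h y)) x ≈ (f ⊛ g) x + (f ⊛ h) x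
    ⊛-distribˡ f g h x = trans (sum-cong-≋ {v} (λ y → distribˡ _ _ _))
      (∑-distrib-+ (λ y → f y * g (y \\ x)) (λ y → f y * h (y \\ x)))

    ⊛-isCommutativeRing : IsCommutativeRing (λ f g → ∀ x → f x ≈ g x) (λ f g x → f x + g x) _⊛_
                          (λ f x → - f x) (λ _ → 0#) (δ ε)
    ⊛-isCommutativeRing = record
      { isRing = record
        { +-isAbelianGroup = Pointwise.isAbelianGroup (Fin v) +-isAbelianGroup
        ; *-cong = ⊛-cong
        ; *-assoc = ⊛-assoc
        ; *-identity = ⊛-identityˡ , λ f x → trans (⊛-comm f (δ ε) x) (⊛-identityˡ f x)
        ; distrib = ⊛-distribˡ , λ f g h x → trans (⊛-comm (λ y → g y + h y) f x)
            (trans (⊛-distribˡ f g h x) (+-cong (⊛-comm f g x) (⊛-comm f h x)))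
        }
      ; *-comm = ⊛-comm
      }

    groupRing : CommutativeRing _ _
    groupRing = record { isCommutativeRing = ⊛-isCommutativeRing }

    private
      module ℛ where
        open import Algebra.Properties.Semiring.Exp (CommutativeRing.semiring groupRing) public using (_^_; ^-congˡ)
        open import Algebra.Properties.Semiring.Sum (CommutativeRing.semiring groupRing) public using (sum)
        open import Algebra.Properties.Semiring.Mult (CommutativeRing.semiring groupRing) public using (_×_)

    open ℛ public using () renaming (_^_ to infixr 8 _⊛^_)
    open import Algebra.Properties.Semiring.Exp semiring
    open import Algebra.Properties.Semiring.Mult semiring

    -- The linear extension of the endomorphism g ↦ gⁿ to the group ring. For f the indicator of D,
    -- the value at x counts the elements of D in one coset of the kernel, and it is 0 when x is not
    -- an n-th power.
    push : ℕ → (Fin v → Carrier) → Fin v → Carrier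
    push n f x = sum (λ y → 𝟙 (x ≟ pow n y) * f y)

    monomial : Carrier → Fin v → Fin v → Carrier
    monomial c a x = 𝟙 (x ≟ a) * c

    sum-eval : ∀ {n} (F : Vector (Fin v → Carrier) n) x → ℛ.sum F x ≡ sum (λ i → F i x)
    sum-eval {zero}  F x = ≡.refl
    sum-eval {suc n} F x = cong (λ s → F Fin.zero x + s) (sum-eval (F ∘ Fin.suc) x)

    ×-eval : ∀ n (f : Fin v → Carrier) x → (n ℛ.× f) x ≡ n × f x
    ×-eval zero    f x = ≡.refl
    ×-eval (suc n) f x = cong (λ s → f x + s) (×-eval n f x)

    monomial-⊛ : ∀ c a d b x → (monomial c a ⊛ monomial d b) x ≈ monomial (c * d) (a ∙ b) x
    monomial-⊛ c a d b x = begin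
      sum (λ y → 𝟙 (y ≟ a) * c * (𝟙 (y \\ x ≟ b) * d)) ≈⟨ sum-cong-≋ {v} (λ y → *-assoc _ _ _) ⟩
      sum (λ y → 𝟙 (y ≟ a) * (c * (𝟙 (y \\ x ≟ b) * d))) ≈⟨ sum-𝟙 a (λ y → c * (𝟙 (y \\ x ≟ b) * d)) ⟩
      c * (𝟙 (a \\ x ≟ b) * d) ≈⟨ *-congˡ (*-congʳ (reflexive (𝟙-cong (a \\ x ≟ b) (x ≟ (a ∙ b)) \\⇒∙ ∙⇒\\))) ⟩
      c * (𝟙 (x ≟ (a ∙ b)) * d)  ≈⟨ sym (*-assoc _ _ _) ⟩
      c * 𝟙 (x ≟ (a ∙ b)) * d    ≈⟨ *-congʳ (*-comm _ _) ⟩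
      𝟙 (x ≟ (a ∙ b)) * c * d    ≈⟨ *-assoc _ _ _ ⟩
      𝟙 (x ≟ (a ∙ b)) * (c * d)  ∎

    monomial-^ : ∀ n c a x → (monomial c a ⊛^ n) x ≈ monomial (c ^ n) (pow n a) x
    monomial-^ zero    c a x = sym (*-identityʳ _)
    monomial-^ (suc n) c a x = trans (⊛-cong {f = monomial c a} (λ _ → refl) (monomial-^ n c a) x)
      (monomial-⊛ c a (c ^ n) (pow n a) x)

    -- With f written as the sum of its monomials, additivity of the p-th power in the group ring
    -- reduces the claim to a single term c·a, whose p-th power is c^p·a^p with c^p ≈ c.
    frobenius : ∀ {p} → Prime p → (∀ c → p × c ≈ 0#) → (∀ c → c ^ p ≈ c) →
                ∀ f x → (f ⊛^ p) x ≈ push p f x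
    frobenius {p} p-prime char fermat f x = begin
      (f ⊛^ p) x
        ≈⟨ ℛ.^-congˡ p decompose x ⟩
      (ℛ.sum (λ y → monomial (f y) y) ⊛^ p) x
        ≈⟨ sum-^p (λ y → monomial (f y) y) x ⟩
      ℛ.sum (λ y → monomial (f y) y ⊛^ p) x
        ≡⟨ sum-eval (λ y → monomial (f y) y ⊛^ p) x ⟩
      sum (λ y → (monomial (f y) y ⊛^ p) x)
        ≈⟨ sum-cong-≋ {v} (λ y → trans (monomial-^ p (f y) y x) (*-congˡ (fermat (f y)))) ⟩
      sum (λ y → 𝟙 (x ≟ pow p y) * f y) ∎
      where
      open PrimeCharacteristic groupRing p-prime
             (λ f x → trans (reflexive (×-eval p f x)) (char (f x)))
      decompose : ∀ x → f x ≈ ℛ.sum (λ y → monomial (f y) y) x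
      decompose x = begin
        f x                              ≈⟨ sum-𝟙 x f ⟨
        sum (λ y → 𝟙 (y ≟ x) * f y)      ≈⟨ sum-cong-≋ {v} (λ y → *-congʳ (reflexive (𝟙-cong (y ≟ x) (x ≟ y) ≡.sym ≡.sym))) ⟩
        sum (λ y → 𝟙 (x ≟ y) * f y)      ≡⟨ sum-eval (λ y → monomial (f y) y) x ⟨
        ℛ.sum (λ y → monomial (f y) y) x ∎

-- Integers modulo k and Fermat's theorem

module Congruence (k : ℤ) where
  open import Data.Integer using (_+_; _*_; _-_; -_)

  infix 4 _≈_

  record _≈_ (a b : ℤ) : Set where
    constructor congruent
    field k∣a-b : k ∣ℤ a - b
  open _≈_ public

  ≡⇒≈ : ∀ {a b} → a ≡ b → a ≈ b
  ≡⇒≈ {a} ≡.refl = congruent (ℤ∣.divides 0ℤ (ℤ.+-inverseʳ a))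

  ∣⇒≈0 : ∀ {a} → k ∣ℤ a → a ≈ 0ℤ
  ∣⇒≈0 {a} d = congruent (subst (k ∣ℤ_) (≡.sym (ℤ.+-identityʳ a)) d)

  ≈0⇒∣ : ∀ {a} → a ≈ 0ℤ → k ∣ℤ a
  ≈0⇒∣ {a} (congruent d) = subst (k ∣ℤ_) (ℤ.+-identityʳ a) d

  isEquivalence : IsEquivalence _≈_
  isEquivalence = record
    { refl  = ≡⇒≈ ≡.refl
    ; sym   = λ {a} {b} (congruent d) → congruent (subst (k ∣ℤ_) (neg a b) (ℤ∣.∣m⇒∣-m d))
    ; trans = λ {a} {b} {c} (congruent d) (congruent e) →
        congruent (subst (k ∣ℤ_) (mid a b c) (ℤ∣.∣m∣n⇒∣m+n d e))
    }
    where
    neg : ∀ a b → - (a - b) ≡ b - a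
    neg = ℤ-Solver.solve-∀
    mid : ∀ a b c → (a - b) + (b - c) ≡ a - c
    mid = ℤ-Solver.solve-∀

  +-cong : ∀ {a b c d} → a ≈ b → c ≈ d → a + c ≈ b + d
  +-cong {a} {b} {c} {d} (congruent e) (congruent f) = congruent (subst (k ∣ℤ_) (eq a b c d) (ℤ∣.∣m∣n⇒∣m+n e f))
    where
    eq : ∀ a b c d → (a - b) + (c - d) ≡ (a + c) - (b + d)
    eq = ℤ-Solver.solve-∀

  *-cong : ∀ {a b c d} → a ≈ b → c ≈ d → a * c ≈ b * d
  *-cong {a} {b} {c} {d} (congruent e) (congruent f) = congruent
    (subst (k ∣ℤ_) (eq a b c d) (ℤ∣.∣m∣n⇒∣m+n (ℤ∣.∣m⇒∣m*n c e) (ℤ∣.∣n⇒∣m*n b f)))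
    where
    eq : ∀ a b c d → (a - b) * c + b * (c - d) ≡ a * c - b * d
    eq = ℤ-Solver.solve-∀

  neg-cong : ∀ {a b} → a ≈ b → - a ≈ - b
  neg-cong {a} {b} (congruent e) = congruent (subst (k ∣ℤ_) (eq a b) (ℤ∣.∣m⇒∣-m e))
    where
    eq : ∀ a b → - (a - b) ≡ - a - - b
    eq = ℤ-Solver.solve-∀

  isCommutativeRing : IsCommutativeRing _≈_ _+_ _*_ -_ 0ℤ 1ℤ
  isCommutativeRing = record
    { isRing = record
      { +-isAbelianGroup = record
        { isGroup = record
          { isMonoid = record
            { isSemigroup = record
              { isMagma = record { isEquivalence = isEquivalence ; ∙-cong = +-cong }
              ; assoc = λ a b c → ≡⇒≈ (ℤ.+-assoc a b c)
              }
            ; identity = (λ a → ≡⇒≈ (ℤ.+-identityˡ a)) , λ a → ≡⇒≈ (ℤ.+-identityʳ a)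
            }
          ; inverse = (λ a → ≡⇒≈ (ℤ.+-inverseˡ a)) , λ a → ≡⇒≈ (ℤ.+-inverseʳ a)
          ; ⁻¹-cong = neg-cong
          }
        ; comm = λ a b → ≡⇒≈ (ℤ.+-comm a b)
        }
      ; *-cong = *-cong
      ; *-assoc = λ a b c → ≡⇒≈ (ℤ.*-assoc a b c)
      ; *-identity = (λ a → ≡⇒≈ (ℤ.*-identityˡ a)) , λ a → ≡⇒≈ (ℤ.*-identityʳ a)
      ; distrib = (λ a b c → ≡⇒≈ (ℤ.*-distribˡ-+ a b c)) , λ a b c → ≡⇒≈ (ℤ.*-distribʳ-+ a b c)
      }
    ; *-comm = λ a b → ≡⇒≈ (ℤ.*-comm a b)
    }

-- The carrier remains ℤ and only the equality is coarsened, so a single integer-valued function is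
-- an element of the group rings over ℤ and over the integers modulo every prime.
ℤ/_ : ℤ → CommutativeRing 0ℓ 0ℓ
ℤ/ k = record { isCommutativeRing = Congruence.isCommutativeRing k }

module ModPrime {p : ℕ} (p-prime : Prime p) where
  open Congruence (+ p) using (∣⇒≈0)
  open CommutativeRing (ℤ/ (+ p))
  open import Algebra.Properties.Semiring.Mult semiring using (_×_)
  open import Algebra.Properties.Semiring.Exp semiring using (_^_; ^-congˡ)
  open import Algebra.Properties.Group +-group using (inverseˡ-unique)
  open import Relation.Binary.Reasoning.Setoid setoid

  ×≡* : ∀ n x → n × x ≡ + n * x
  ×≡* zero    x = ≡.refl
  ×≡* (suc n) x = ≡.trans (cong (λ y → x + y) (×≡* n x)) (≡.sym (ℤ.suc-* (+ n) x))

  characteristic : ∀ x → p × x ≈ 0#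
  characteristic x = ∣⇒≈0 (subst (+ p ∣ℤ_) (≡.sym (×≡* p x)) (ℤ∣.∣m⇒∣m*n x ℤ∣.∣-refl))

  open PrimeCharacteristic (ℤ/ (+ p)) p-prime characteristic public

  fermat-+ : ∀ n → (+ n) ^ p ≈ + n
  fermat-+ zero    = 0^p≈0
  fermat-+ (suc n) = trans (+-^p 1# (+ n)) (+-cong (1^ p) (fermat-+ n))
    where
    1^ : ∀ n → 1# ^ n ≈ 1#
    1^ zero    = refl
    1^ (suc n) = trans (*-identityˡ _) (1^ n)

  fermat : ∀ x → x ^ p ≈ x
  fermat (+ n)    = fermat-+ n
  fermat -[1+ n ] = begin
    -- Additivity applied to -(n + 1) + (n + 1) = 0 makes the two p-th powers opposite, with no
    -- separate treatment of p = 2.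
    -[1+ n ] ^ p       ≈⟨ inverseˡ-unique _ _ (trans (sym (+-^p -[1+ n ] (+ suc n)))
                            (trans (^-congˡ p (-‿inverseˡ (+ suc n))) 0^p≈0)) ⟩
    - ((+ suc n) ^ p)  ≈⟨ -‿cong (fermat-+ (suc n)) ⟩
    -[1+ n ]           ∎

-- Integer sums, involutions and bounds

module Counting where
  open import Data.Integer using (_+_; _*_; _-_; -_; _≤_; ∣_∣)
  open import Algebra.Properties.Semiring.Sum (CommutativeRing.semiring ℤ.+-*-commutativeRing)
  open Indicator ℤ.+-*-commutativeRing
  open import Data.Product using (_×_)

  sum-mono : ∀ {n} {f g : Fin n → ℤ} → (∀ i → f i ≤ g i) → sum f ≤ sum g
  sum-mono {zero}  f≤g = ℤ.≤-refl
  sum-mono {suc n} f≤g = ℤ.+-mono-≤ (f≤g Fin.zero) (sum-mono (f≤g ∘ Fin.suc))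

  sum-nonneg : ∀ {n} {f : Fin n → ℤ} → (∀ i → 0ℤ ≤ f i) → 0ℤ ≤ sum f
  sum-nonneg {n} {f} 0≤f = subst (_≤ sum f) (sum-replicate-zero n) (sum-mono {f = λ _ → 0ℤ} 0≤f)

  sum-1 : ∀ n → sum {n} (λ _ → 1ℤ) ≡ + n
  sum-1 zero    = ≡.refl
  sum-1 (suc n) = cong (λ k → 1ℤ + k) (sum-1 n)

  0≤𝟙 : ∀ {a} {P : Set a} (P? : Dec P) → 0ℤ ≤ 𝟙 P?
  0≤𝟙 (yes _) = ℤ.+≤+ z≤n
  0≤𝟙 (no _)  = ℤ.+≤+ z≤n

  -- The order on `Fin n` splits the moved points into those with y < σ y and those with σ y < y; σ
  -- exchanges the two sets, and the invariant f gives them equal sums.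
  sum-involution : ∀ {n} (σ : Fin n → Fin n) → (∀ y → σ (σ y) ≡ y) → (f : Fin n → ℤ) → (∀ y → f (σ y) ≡ f y) →
                   ∃ λ t → sum f ≡ sum (λ y → 𝟙 (σ y ≟ y) * f y) + (t + t)
  sum-involution {n} σ σσ f fσ = sum ascents , (begin
    sum f                                                ≡⟨ sum-cong-≗ {n} split ⟩
    sum (λ y → fixed y + (ascents y + descents y))       ≡⟨ ∑-distrib-+ fixed (λ y → ascents y + descents y) ⟩
    sum fixed + sum (λ y → ascents y + descents y)       ≡⟨ cong (λ s → sum fixed + s) (∑-distrib-+ ascents descents) ⟩
    sum fixed + (sum ascents + sum descents)             ≡⟨ cong (λ s → sum fixed + (sum ascents + s)) swap ⟩
    sum fixed + (sum ascents + sum ascents)              ∎)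
    where
    open ≡-Reasoning
    fixed ascents descents : Fin n → ℤ
    fixed    y = 𝟙 (σ y ≟ y) * f y
    ascents  y = 𝟙 (y Fin.<? σ y) * f y
    descents y = 𝟙 (σ y Fin.<? y) * f y

    split : ∀ y → f y ≡ fixed y + (ascents y + descents y)
    split y with Fin.<-cmp (σ y) y
    ... | tri< lt ¬eq ¬gt rewrite 𝟙-no (σ y ≟ y) ¬eq | 𝟙-no (y Fin.<? σ y) ¬gt | 𝟙-yes (σ y Fin.<? y) lt =
          ≡.sym (≡.trans (ℤ.+-identityˡ _) (≡.trans (ℤ.+-identityˡ _) (ℤ.*-identityˡ _)))
    ... | tri≈ ¬lt eq ¬gt rewrite 𝟙-yes (σ y ≟ y) eq | 𝟙-no (y Fin.<? σ y) ¬gt | 𝟙-no (σ y Fin.<? y) ¬lt =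
          ≡.sym (≡.trans (ℤ.+-identityʳ _) (ℤ.*-identityˡ _))
    ... | tri> ¬lt ¬eq gt rewrite 𝟙-no (σ y ≟ y) ¬eq | 𝟙-yes (y Fin.<? σ y) gt | 𝟙-no (σ y Fin.<? y) ¬lt =
          ≡.sym (≡.trans (ℤ.+-identityˡ _) (≡.trans (ℤ.+-identityʳ _) (ℤ.*-identityˡ _)))

    swap : sum descents ≡ sum ascents
    swap = ≡.trans (∑-permute descents (permutation σ σ σσ σσ))
      (sum-cong-≗ {n} (λ y → cong₂ _*_ (cong (λ x → 𝟙 (x Fin.<? σ y)) (σσ y)) (fσ y)))

  sum-except : ∀ {n} (a : Fin n) (f : Fin n → ℤ) → (∀ y → y ≢ a → 0ℤ ≤ f y) → f a ≤ sum f
  sum-except {n} a f 0≤f = subst (_≤ sum f) (sum-𝟙 a f) (sum-mono term)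
    where
    term : ∀ y → 𝟙 (y ≟ a) * f y ≤ f y
    term y with y ≟ a
    ... | yes _  = ℤ.≤-reflexive (ℤ.*-identityˡ (f y))
    ... | no y≢a = 0≤f y y≢a

  -- Power maps: kernels, fibres and second moments

  module PowerMap {v : ℕ} {_∙_ : Op₂ (Fin v)} {ε : Fin v} {_⁻¹ : Op₁ (Fin v)}
    (isAbelianGroup : IsAbelianGroup _≡_ _∙_ ε _⁻¹) where

    open FiniteAbelianGroup isAbelianGroup
    open GroupRing ℤ.+-*-commutativeRing using (push; _⊛_)

    pow-ε : ∀ n → pow n ε ≡ ε
    pow-ε zero    = ≡.refl
    pow-ε (suc n) = ≡.trans (identityˡ _) (pow-ε n)

    pow-kernel-* : ∀ m {n y} → pow n y ≡ ε → pow (m ℕ.* n) y ≡ ε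
    pow-kernel-* m {n} {y} eq = ≡.trans (≡.sym (pow-* y m n)) (≡.trans (cong (pow m) eq) (pow-ε m))

    pow-⁻¹ : ∀ n y → pow n (y ⁻¹) ≡ pow n y ⁻¹
    pow-⁻¹ n y = inverseˡ-unique _ _ (≡.trans (≡.sym (pow-∙ (y ⁻¹) y n))
      (≡.trans (cong (pow n) (inverseˡ y)) (pow-ε n)))

    pow-kernel-\\ : ∀ n {y} x → pow n y ≡ ε → pow n (y \\ x) ≡ pow n x
    pow-kernel-\\ n {y} x eq = ≡.trans (pow-∙ (y ⁻¹) x n)
      (≡.trans (cong (_∙ pow n x) (≡.trans (pow-⁻¹ n y) (≡.trans (cong _⁻¹ eq) ε⁻¹≈ε))) (identityˡ _))

    -- The product of all elements is unchanged by the translation x ↦ y ∙ x, which multiplies it by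
    -- the v-th power of y.
    lagrange : ∀ y → pow v y ≡ ε
    lagrange y = ≡.trans (≡.sym (∑G.sum-replicate v)) (identityˡ-unique _ _ (begin
      ∑G.sum {v} (λ _ → y) ∙ ∑G.sum (λ x → x)  ≡⟨ ∑G.∑-distrib-+ (λ _ → y) (λ x → x) ⟨
      ∑G.sum (y ∙_)                            ≡⟨ ∑G.∑-permute (λ x → x) (translation y) ⟨
      ∑G.sum (λ x → x)                         ∎))
      where
      open ≡-Reasoning
      module ∑G where
        open import Algebra.Properties.CommutativeMonoid.Sum commutativeMonoid public

    pow-coprime : ∀ {m n y} → Coprime m n → pow m y ≡ ε → pow n y ≡ ε → y ≡ ε
    pow-coprime {m} {n} {y} m⊥n mε nε with coprime-Bézout m⊥n
    ... | Bézout.+- a b eq = begin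
      y                        ≡⟨ identityʳ y ⟨
      y ∙ ε                    ≡⟨ cong (y ∙_) (pow-kernel-* b nε) ⟨
      pow (1 ℕ.+ b ℕ.* n) y    ≡⟨ cong (λ k → pow k y) eq ⟩
      pow (a ℕ.* m) y          ≡⟨ pow-kernel-* a mε ⟩
      ε                        ∎
      where open ≡-Reasoning
    ... | Bézout.-+ a b eq = begin
      y                        ≡⟨ identityʳ y ⟨
      y ∙ ε                    ≡⟨ cong (y ∙_) (pow-kernel-* a mε) ⟨
      pow (1 ℕ.+ a ℕ.* m) y    ≡⟨ cong (λ k → pow k y) eq ⟩
      pow (b ℕ.* n) y          ≡⟨ pow-kernel-* b nε ⟩
      ε                        ∎
      where open ≡-Reasoning

    pow-injective : ∀ {m n x y} → Coprime m n → pow n x ≡ pow n y → pow m x ≡ pow m y → x ≡ y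
    pow-injective {m} {n} {x} {y} m⊥n eq eq′ = x∙y⁻¹≈ε⇒x≈y x y (pow-coprime m⊥n (ker m eq′) (ker n eq))
      where
      ker : ∀ k → pow k x ≡ pow k y → pow k (x ∙ (y ⁻¹)) ≡ ε
      ker k e = ≡.trans (pow-∙ x (y ⁻¹) k) (≡.trans (cong (_∙ pow k (y ⁻¹)) e)
        (≡.trans (cong (pow k y ∙_) (pow-⁻¹ k y)) (inverseʳ _)))

    root : ∀ {m n z} → Coprime m n → pow n z ≡ ε → ∃ λ u → pow m u ≡ z
    root {m} {n} {z} m⊥n nε with coprime-Bézout m⊥n
    ... | Bézout.+- a b eq = pow a z , (begin
      pow m (pow a z)          ≡⟨ pow-* z m a ⟩
      pow (m ℕ.* a) z          ≡⟨ cong (λ k → pow k z) (≡.trans (ℕ.*-comm m a) (≡.sym eq)) ⟩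
      pow (1 ℕ.+ b ℕ.* n) z    ≡⟨ cong (z ∙_) (pow-kernel-* b nε) ⟩
      z ∙ ε                    ≡⟨ identityʳ z ⟩
      z                        ∎)
      where open ≡-Reasoning
    ... | Bézout.-+ a b eq = pow a z ⁻¹ , (begin
      pow m (pow a z ⁻¹)       ≡⟨ pow-⁻¹ m (pow a z) ⟩
      pow m (pow a z) ⁻¹       ≡⟨ cong _⁻¹ (≡.trans (pow-* z m a) (cong (λ k → pow k z) (ℕ.*-comm m a))) ⟩
      pow (a ℕ.* m) z ⁻¹       ≡⟨ inverseˡ-unique z (pow (a ℕ.* m) z)
                                    (≡.trans (cong (λ k → pow k z) eq) (pow-kernel-* b nε)) ⟨
      z                        ∎)
      where open ≡-Reasoning

    ker : ℕ → Fin v → ℤ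
    ker q y = 𝟙 (pow q y ≟ ε)

    ∣ker_∣ : ℕ → ℤ
    ∣ker q ∣ = sum (ker q)

    -- Adjunction between pushing f forward and pulling g back along `pow q`.
    sum-push : ∀ q (f g : Fin v → ℤ) → sum (λ z → push q f z * g z) ≡ sum (λ y → f y * g (pow q y))
    sum-push q f g = begin
      sum (λ z → push q f z * g z)
        ≡⟨ sum-cong-≗ {v} (λ z → *-distribʳ-sum (g z) (λ y → 𝟙 (z ≟ pow q y) * f y)) ⟩
      sum (λ z → sum (λ y → 𝟙 (z ≟ pow q y) * f y * g z))
        ≡⟨ ∑-comm (λ z y → 𝟙 (z ≟ pow q y) * f y * g z) ⟩
      sum (λ y → sum (λ z → 𝟙 (z ≟ pow q y) * f y * g z))
        ≡⟨ sum-cong-≗ {v} (λ y → sum-cong-≗ {v} (λ z → ℤ.*-assoc (𝟙 (z ≟ pow q y)) (f y) (g z))) ⟩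
      sum (λ y → sum (λ z → 𝟙 (z ≟ pow q y) * (f y * g z)))
        ≡⟨ sum-cong-≗ {v} (λ y → sum-𝟙 (pow q y) (λ z → f y * g z)) ⟩
      sum (λ y → f y * g (pow q y)) ∎
      where open ≡-Reasoning

    sum-push-1 : ∀ q f → sum (push q f) ≡ sum f
    sum-push-1 q f = begin
      sum (push q f)               ≡⟨ sum-cong-≗ {v} (λ z → ℤ.*-identityʳ (push q f z)) ⟨
      sum (λ z → push q f z * 1ℤ)  ≡⟨ sum-push q f (λ _ → 1ℤ) ⟩
      sum (λ y → f y * 1ℤ)         ≡⟨ sum-cong-≗ {v} (λ y → ℤ.*-identityʳ (f y)) ⟩
      sum f                        ∎
      where open ≡-Reasoning

    -- By Lagrange every q-th power is killed by w, which confines the support of `push q f` to the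
    -- kernel of `pow w`.
    push-ker : ∀ {q w} → v ≡ q ℕ.* w → ∀ f z → ker w z * push q f z ≡ push q f z
    push-ker {q} {w} v≡qw f z = begin
      ker w z * push q f z                              ≡⟨ *-distribˡ-sum (ker w z) (λ y → 𝟙 (z ≟ pow q y) * f y) ⟩
      sum (λ y → ker w z * (𝟙 (z ≟ pow q y) * f y))     ≡⟨ sum-cong-≗ {v} term ⟩
      sum (λ y → 𝟙 (z ≟ pow q y) * f y)                 ∎
      where
      open ≡-Reasoning
      term : ∀ y → ker w z * (𝟙 (z ≟ pow q y) * f y) ≡ 𝟙 (z ≟ pow q y) * f y
      term y with z ≟ pow q y
      ... | no _   = ℤ.*-zeroʳ (ker w z)
      ... | yes eq = ≡.trans (cong (_* (1ℤ * f y)) (𝟙-yes (pow w z ≟ ε) wz)) (ℤ.*-identityˡ _)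
        where
        wz : pow w z ≡ ε
        wz = begin
          pow w z         ≡⟨ cong (pow w) eq ⟩
          pow w (pow q y) ≡⟨ pow-* y w q ⟩
          pow (w ℕ.* q) y ≡⟨ cong (λ k → pow k y) (≡.trans (ℕ.*-comm w q) (≡.sym v≡qw)) ⟩
          pow v y         ≡⟨ lagrange y ⟩
          ε               ∎

    fibre-size : ∀ q u → push q (λ _ → 1ℤ) (pow q u) ≡ ∣ker q ∣
    fibre-size q u = begin
      sum (λ y → 𝟙 (pow q u ≟ pow q y) * 1ℤ)       ≡⟨ ∑-permute _ (translation u) ⟩
      sum (λ y → 𝟙 (pow q u ≟ pow q (u ∙ y)) * 1ℤ) ≡⟨ sum-cong-≗ {v} (λ y → ≡.trans (ℤ.*-identityʳ _)
                                                        (𝟙-cong (pow q u ≟ pow q (u ∙ y)) (pow q y ≟ ε) (to y) (from y))) ⟩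
      sum (ker q)                                  ∎
      where
      open ≡-Reasoning
      to : ∀ y → pow q u ≡ pow q (u ∙ y) → pow q y ≡ ε
      to y eq = identityʳ-unique (pow q u) (pow q y) (≡.sym (≡.trans eq (pow-∙ u y q)))
      from : ∀ y → pow q y ≡ ε → pow q u ≡ pow q (u ∙ y)
      from y eq = ≡.sym (≡.trans (pow-∙ u y q) (≡.trans (cong (pow q u ∙_) eq) (identityʳ _)))

    -- Coprimality makes `pow q` map onto the kernel of `pow w`, and every nonempty fibre is a
    -- translate of the kernel of `pow q`.
    ∣ker∣*∣ker∣ : ∀ {q w} → v ≡ q ℕ.* w → Coprime q w → ∣ker q ∣ * ∣ker w ∣ ≡ + v
    ∣ker∣*∣ker∣ {q} {w} v≡qw q⊥w = begin
      ∣ker q ∣ * ∣ker w ∣             ≡⟨ ℤ.*-comm ∣ker q ∣ ∣ker w ∣ ⟩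
      ∣ker w ∣ * ∣ker q ∣             ≡⟨ *-distribʳ-sum ∣ker q ∣ (ker w) ⟩
      sum (λ z → ker w z * ∣ker q ∣)  ≡⟨ sum-cong-≗ {v} (λ z → 𝟙-guard (pow w z ≟ ε) (fibre z)) ⟩
      sum (λ z → ker w z * push q (λ _ → 1ℤ) z) ≡⟨ sum-cong-≗ {v} (push-ker {q} {w} v≡qw (λ _ → 1ℤ)) ⟩
      sum (push q (λ _ → 1ℤ))         ≡⟨ sum-push-1 q (λ _ → 1ℤ) ⟩
      sum {v} (λ _ → 1ℤ)              ≡⟨ sum-1 v ⟩
      + v                             ∎
      where
      open ≡-Reasoning
      fibre : ∀ z → pow w z ≡ ε → ∣ker q ∣ ≡ push q (λ _ → 1ℤ) z
      fibre z wz with root q⊥w wz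
      ... | u , ≡.refl = ≡.sym (fibre-size q u)

    -- If p divided the order of the kernel, its indicator χ would satisfy χ ⊛ χ ≈ 0 modulo p,
    -- whereas the Frobenius map leaves the coefficient 1 of χ at ε unchanged.
    prime-∤-∣ker∣ : ∀ {p q} → Prime p → Coprime p q → ¬ (+ p ∣ℤ ∣ker q ∣)
    prime-∤-∣ker∣ {p} {q} p-prime p⊥q p∣ker = ℕ.<⇒≱ 1<p (ℕ∣.∣⇒≤ (ℤ∣.∣⇒∣ᵤ (≈0⇒∣ 1≈0)))
      where
      open Congruence (+ p) using (≡⇒≈; ∣⇒≈0; ≈0⇒∣)
      open CommutativeRing (ℤ/ (+ p)) using (_≈_; trans; sym)
      module M = GroupRing (ℤ/ (+ p))
      module MR = CommutativeRing M.groupRing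
      1<p : 1 ℕ.< p
      1<p = ℕ.nonTrivial⇒n>1 p {{prime⇒nonTrivial p-prime}}

      χ⊛χ : ∀ x → (ker q ⊛ ker q) x ≡ ∣ker q ∣ * ker q x
      χ⊛χ x = ≡.trans (sum-cong-≗ {v} (λ y → 𝟙-guard (pow q y ≟ ε)
          (λ eq → cong (λ z → 𝟙 (z ≟ ε)) (pow-kernel-\\ q x eq))))
        (≡.sym (*-distribʳ-sum (ker q x) (ker q)))

      χ⊛χ≈0 : ∀ x → (ker q M.⊛ ker q) x ≈ 0ℤ
      χ⊛χ≈0 x = ∣⇒≈0 (subst (+ p ∣ℤ_) (≡.sym (χ⊛χ x)) (ℤ∣.∣m⇒∣m*n (ker q x) p∣ker))

      χ^≈0 : ∀ n → 1 ℕ.< n → ∀ x → (ker q M.⊛^ n) x ≈ 0ℤ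
      χ^≈0 (suc (suc n)) _ x = trans (sym (M.⊛-assoc (ker q) (ker q) (ker q M.⊛^ n) x))
        (trans (M.⊛-cong {g = ker q M.⊛^ n} χ⊛χ≈0 (λ _ → ≡⇒≈ ≡.refl) x) (MR.zeroˡ (ker q M.⊛^ n) x))
      χ^≈0 (suc zero) (s≤s ())

      push-χ : push p (ker q) ε ≡ 1ℤ
      push-χ = begin
        sum (λ y → 𝟙 (ε ≟ pow p y) * ker q y)  ≡⟨ sum-cong-≗ {v} term ⟩
        sum (λ y → 𝟙 (y ≟ ε) * 1ℤ)             ≡⟨ sum-𝟙 ε (λ _ → 1ℤ) ⟩
        1ℤ                                     ∎
        where
        open ≡-Reasoning
        term : ∀ y → 𝟙 (ε ≟ pow p y) * ker q y ≡ 𝟙 (y ≟ ε) * 1ℤ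
        term y with y ≟ ε
        ... | yes ≡.refl = cong₂ _*_ (𝟙-yes (ε ≟ pow p ε) (≡.sym (pow-ε p))) (𝟙-yes (pow q ε ≟ ε) (pow-ε q))
        ... | no y≢ε with ε ≟ pow p y | pow q y ≟ ε
        ...   | yes eq | yes eq′ = contradiction (pow-coprime p⊥q (≡.sym eq) eq′) y≢ε
        ...   | yes _  | no _    = ≡.refl
        ...   | no _   | yes _   = ≡.refl
        ...   | no _   | no _    = ≡.refl

      1≈0 : 1ℤ ≈ 0ℤ
      1≈0 = trans (≡⇒≈ (≡.sym push-χ)) (trans (sym (M.frobenius p-prime
        (ModPrime.characteristic p-prime) (ModPrime.fermat p-prime) (ker q) ε)) (χ^≈0 p 1<p ε))

    -- The preceding lemma plays the part of Cauchy's theorem: a prime dividing the order of the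
    -- q-torsion divides q, hence cannot divide w.
    coprime-∣ker∣ : ∀ {q w} → .{{NonZero w}} → Coprime q w → Coprime ∣ ∣ker q ∣ ∣ w
    coprime-∣ker∣ {q} {w} q⊥w = no-common-prime⇒coprime λ {p} p-prime p∣a p∣w →
      prime-∤-∣ker∣ {p} {q} p-prime (λ (d∣p , d∣q) → q⊥w (d∣q , ℕ∣.∣-trans d∣p p∣w)) (ℤ∣.∣ᵤ⇒∣ p∣a)

    -- The Sylow count by divisibility alone: in |ker q| · |ker w| = q · w the factor |ker q| is
    -- coprime to w and |ker w| is coprime to q, so |ker q| and q divide each other.
    ∣ker∣≡ : ∀ {q w} → v ≡ q ℕ.* w → .{{NonZero q}} → .{{NonZero w}} → Coprime q w → ∣ker q ∣ ≡ + q
    ∣ker∣≡ {q} {w} v≡qw q⊥w = ≡.trans (≡.sym (ℤ.0≤i⇒+∣i∣≡i (sum-nonneg (λ y → 0≤𝟙 (pow q y ≟ ε)))))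
      (cong +_ (ℕ∣.∣-antisym a∣q q∣a))
      where
      a b : ℕ
      a = ∣ ∣ker q ∣ ∣
      b = ∣ ∣ker w ∣ ∣
      ab≡qw : a ℕ.* b ≡ q ℕ.* w
      ab≡qw = ≡.trans (≡.sym (ℤ.abs-* ∣ker q ∣ ∣ker w ∣))
        (≡.trans (cong ∣_∣ (∣ker∣*∣ker∣ {q} {w} v≡qw q⊥w)) v≡qw)
      a∣q : a ∣ q
      a∣q = coprime-divisor (coprime-∣ker∣ {q} q⊥w)
        (ℕ∣.divides b (≡.trans (ℕ.*-comm w q) (≡.trans (≡.sym ab≡qw) (ℕ.*-comm a b))))
      q∣a : q ∣ a
      q∣a = coprime-divisor (Coprime.sym (coprime-∣ker∣ {w} (Coprime.sym q⊥w)))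
        (ℕ∣.divides w (≡.trans (ℕ.*-comm b a) (≡.trans ab≡qw (ℕ.*-comm q w))))

    push-* : ∀ m n (f : Fin v → ℤ) z → push (m ℕ.* n) f z ≡ push m (push n f) z
    push-* m n f z = begin
      sum (λ y → 𝟙 (z ≟ pow (m ℕ.* n) y) * f y)
        ≡⟨ sum-cong-≗ {v} (λ y → ≡.trans (cong (λ x → 𝟙 (z ≟ x) * f y) (≡.sym (pow-* y m n)))
                                         (ℤ.*-comm (𝟙 (z ≟ pow m (pow n y))) (f y))) ⟩
      sum (λ y → f y * 𝟙 (z ≟ pow m (pow n y)))
        ≡⟨ sum-push n f (λ x → 𝟙 (z ≟ pow m x)) ⟨
      sum (λ x → push n f x * 𝟙 (z ≟ pow m x))
        ≡⟨ sum-cong-≗ {v} (λ x → ℤ.*-comm (push n f x) (𝟙 (z ≟ pow m x))) ⟩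
      sum (λ x → 𝟙 (z ≟ pow m x) * push n f x) ∎
      where open ≡-Reasoning

    push-ε : ∀ q f → push q f ε ≡ sum (λ y → ker q y * f y)
    push-ε q f = sum-cong-≗ {v} (λ y → cong (_* f y) (𝟙-cong (ε ≟ pow q y) (pow q y ≟ ε) ≡.sym ≡.sym))

    -- The left side sums f y · f y′ over pairs in a common fibre, that is, pairs whose quotient x
    -- lies in the kernel. The symmetry of f turns quotients into products, so that the pairs with a
    -- given x add up to a convolution.
    push-square : ∀ q (f : Fin v → ℤ) → (∀ y → f (y ⁻¹) ≡ f y) →
                  sum (λ z → push q f z * push q f z) ≡ sum (λ x → ker q x * (f ⊛ f) x)
    push-square q f f⁻¹ = begin
      sum (λ z → push q f z * push q f z)
        ≡⟨ sum-push q f (push q f) ⟩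
      sum (λ y → f y * push q f (pow q y))
        ≡⟨ sum-cong-≗ {v} (λ y → cong (f y *_) (fibre y)) ⟩
      sum (λ y → f y * sum (λ x → ker q x * f (y \\ x)))
        ≡⟨ sum-cong-≗ {v} (λ y → *-distribˡ-sum (f y) (λ x → ker q x * f (y \\ x))) ⟩
      sum (λ y → sum (λ x → f y * (ker q x * f (y \\ x))))
        ≡⟨ ∑-comm (λ y x → f y * (ker q x * f (y \\ x))) ⟩
      sum (λ x → sum (λ y → f y * (ker q x * f (y \\ x))))
        ≡⟨ sum-cong-≗ {v} (λ x → sum-cong-≗ {v} (λ y → x∙yz≈y∙xz (f y) (ker q x) (f (y \\ x)))) ⟩
      sum (λ x → sum (λ y → ker q x * (f y * f (y \\ x))))
        ≡⟨ sum-cong-≗ {v} (λ x → *-distribˡ-sum (ker q x) (λ y → f y * f (y \\ x))) ⟨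
      sum (λ x → ker q x * (f ⊛ f) x) ∎
      where
      open ≡-Reasoning
      open import Algebra.Properties.CommutativeSemigroup ℤ.*-commutativeSemigroup using (x∙yz≈y∙xz)
      to : ∀ x y → pow q y ≡ pow q (x \\ y) → pow q x ≡ ε
      to x y eq = identityʳ-unique (pow q (x \\ y)) (pow q x)
        (≡.trans (≡.sym (pow-∙ (x \\ y) x q)) (≡.trans (cong (pow q) (≡.trans (comm (x \\ y) x) (\\-leftDividesˡ x y))) eq))
      fibre : ∀ y → push q f (pow q y) ≡ sum (λ x → ker q x * f (y \\ x))
      fibre y = ≡.trans (∑-permute (λ x → 𝟙 (pow q y ≟ pow q x) * f x) (involution (_\\ y) (\\-involutive y)))
        (sum-cong-≗ {v} (λ x → cong₂ _*_
          (𝟙-cong (pow q y ≟ pow q (x \\ y)) (pow q x ≟ ε) (to x y) (λ eq → ≡.sym (pow-kernel-\\ q y eq)))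
          (≡.trans (≡.sym (f⁻¹ (x \\ y))) (cong f (⁻¹-anti-homo-\\ x y)))))

  -- List counts and cardinalities as sums of indicators

  𝟙-× : ∀ {a b} {P : Set a} {Q : Set b} (P? : Dec P) (Q? : Dec Q) → 𝟙 (P? ×-dec Q?) ≡ 𝟙 P? * 𝟙 Q?
  𝟙-× (yes _) (yes _) = ≡.refl
  𝟙-× (yes _) (no _)  = ≡.refl
  𝟙-× (no _)  (yes _) = ≡.refl
  𝟙-× (no _)  (no _)  = ≡.refl

  𝟙-idem : ∀ {a} {P : Set a} (P? : Dec P) → 𝟙 P? * 𝟙 P? ≡ 𝟙 P?
  𝟙-idem (yes _) = ≡.refl
  𝟙-idem (no _)  = ≡.refl

  module _ {a p : Level} {A : Set a} {P : Pred A p} (P? : Decidable P) where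

    count-tabulate : ∀ {n} (f : Fin n → A) → + length (filter P? (tabulate f)) ≡ sum (λ i → 𝟙 (P? (f i)))
    count-tabulate {zero}  f = ≡.refl
    count-tabulate {suc n} f with P? (f Fin.zero)
    ... | yes _ = cong (λ s → 1ℤ + s) (count-tabulate (f ∘ Fin.suc))
    ... | no _  = ≡.trans (count-tabulate (f ∘ Fin.suc)) (≡.sym (ℤ.+-identityˡ _))

    count-concatMap : ∀ {b n} {B : Set b} (F : B → List A) (f : Fin n → B) →
      + length (filter P? (concatMap F (tabulate f))) ≡ sum (λ i → + length (filter P? (F (f i))))
    count-concatMap {n = zero}  F f = ≡.refl
    count-concatMap {n = suc n} F f = begin
      + length (filter P? (F (f Fin.zero) List.++ concatMap F (tabulate (f ∘ Fin.suc))))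
        ≡⟨ cong (λ l → + length l) (List.filter-++ P? (F (f Fin.zero)) _) ⟩
      + length (filter P? (F (f Fin.zero)) List.++ filter P? (concatMap F (tabulate (f ∘ Fin.suc))))
        ≡⟨ cong +_ (List.length-++ (filter P? (F (f Fin.zero)))) ⟩
      + length (filter P? (F (f Fin.zero))) + + length (filter P? (concatMap F (tabulate (f ∘ Fin.suc))))
        ≡⟨ cong (λ s → + length (filter P? (F (f Fin.zero))) + s) (count-concatMap F (f ∘ Fin.suc)) ⟩
      sum (λ i → + length (filter P? (F (f i)))) ∎
      where open ≡-Reasoning

  count-allPairs : ∀ {p} v {P : Pred (Fin v × Fin v) p} (P? : Decidable P) →
    + length (filter P? (allPairs v)) ≡ sum (λ g → sum (λ h → 𝟙 (P? (g , h))))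
  count-allPairs v P? = ≡.trans (count-concatMap P? (λ g → List.map (λ h → (g , h)) (allFin v)) id)
    (sum-cong-≗ {v} (λ g → ≡.trans
      (cong (λ l → + length (filter P? l)) (List.map-tabulate id (λ h → (g , h))))
      (count-tabulate P? (λ h → (g , h)))))

  ∣∣≡sum : ∀ {n} (D : Subset n) → + Subset.∣ D ∣ ≡ sum (λ y → 𝟙 (y ∈? D))
  ∣∣≡sum []            = ≡.refl
  ∣∣≡sum {suc n} (s ∷ D) = step s
    where
    tail≡ : sum (λ y → 𝟙 (y ∈? D)) ≡ sum (λ y → 𝟙 (Fin.suc y ∈? (s ∷ D)))
    tail≡ = sum-cong-≗ {n} (λ y → 𝟙-cong (y ∈? D) (Fin.suc y ∈? (s ∷ D)) Vec.there drop-there)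
    step : ∀ t → + Subset.∣ t ∷ D ∣ ≡ 𝟙 (Fin.zero ∈? (t ∷ D)) + sum (λ y → 𝟙 (Fin.suc y ∈? (s ∷ D)))
    step inside  = cong (λ k → 1ℤ + k) (≡.trans (∣∣≡sum D) tail≡)
    step outside = ≡.trans (∣∣≡sum D) (≡.trans tail≡ (≡.sym (ℤ.+-identityˡ _)))

  -- The integer inequalities behind the fibre counts

  0≤i*i : ∀ i → 0ℤ ≤ i * i
  0≤i*i (+ n)    = subst (0ℤ ≤_) (ℤ.pos-* n n) (ℤ.+≤+ z≤n)
  0≤i*i -[1+ n ] = ℤ.+≤+ z≤n

  0≤i*i-i : ∀ i → 0ℤ ≤ i * i - i
  0≤i*i-i (+ zero)  = ℤ.+≤+ z≤n
  0≤i*i-i (+ suc n) = subst (0ℤ ≤_) (≡.trans (ℤ.pos-* (suc n) n) (eq (+ n))) (ℤ.+≤+ z≤n)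
    where
    eq : ∀ m → (1ℤ + m) * m ≡ (1ℤ + m) * (1ℤ + m) - (1ℤ + m)
    eq = ℤ-Solver.solve-∀
  0≤i*i-i -[1+ n ]  = ℤ.+≤+ z≤n

  0≤+ : ∀ {i j} → 0ℤ ≤ i → 0ℤ ≤ j → 0ℤ ≤ i + j
  0≤+ = ℤ.+-mono-≤

  0≤* : ∀ {i j} → 0ℤ ≤ i → 0ℤ ≤ j → 0ℤ ≤ i * j
  0≤* {+ m} {+ n} _ _ = subst (0ℤ ≤_) (ℤ.pos-* m n) (ℤ.+≤+ z≤n)

  -- An integer ≡ f (mod 2) and ≡ 0 (mod 3) is a multiple of 6 when f = 0.
  fibre-inequality : ∀ {x f t} → x ≡ f + (t + t) → + 3 ∣ℤ x → 0ℤ ≤ f → 0ℤ ≤ x * x + (- + 6 * x + + 9 * f)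
  fibre-inequality {x} {+ zero} {t} x≡ (ℤ∣.divides s x≡3s) _ =
    subst (0ℤ ≤_) (≡.sym (≡.trans (cong (λ y → y * y + (- + 6 * y + + 9 * 0ℤ)) x≡6j) (eq (t - s))))
      (0≤* {+ 36} (ℤ.+≤+ z≤n) (0≤i*i-i (t - s)))
    where
    eq : ∀ j → + 6 * j * (+ 6 * j) + (- + 6 * (+ 6 * j) + + 9 * 0ℤ) ≡ + 36 * (j * j - j)
    eq = ℤ-Solver.solve-∀
    x≡6j : x ≡ + 6 * (t - s)
    x≡6j = begin
      x                                    ≡⟨ split x ⟩
      + 3 * x - + 2 * x                    ≡⟨ cong₂ (λ a b → + 3 * a - + 2 * b) x≡ x≡3s ⟩
      + 3 * (0ℤ + (t + t)) - + 2 * (s * + 3) ≡⟨ join t s ⟩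
      + 6 * (t - s)                        ∎
      where
      open ≡-Reasoning
      split : ∀ x → x ≡ + 3 * x - + 2 * x
      split = ℤ-Solver.solve-∀
      join : ∀ t s → + 3 * (0ℤ + (t + t)) - + 2 * (s * + 3) ≡ + 6 * (t - s)
      join = ℤ-Solver.solve-∀
  fibre-inequality {x} {+ suc m} _ _ _ =
    subst (0ℤ ≤_) (eq x (+ m)) (0≤+ (0≤i*i (x - + 3)) (0≤* {+ 9} {+ m} (ℤ.+≤+ z≤n) (ℤ.+≤+ z≤n)))
    where
    eq : ∀ x m → (x - + 3) * (x - + 3) + + 9 * m ≡ x * x + (- + 6 * x + + 9 * (1ℤ + m))
    eq = ℤ-Solver.solve-∀

  -- With q = 3(k₁ - r) - rM the hypothesis reads q (q + 9M) ≤ 0, which excludes q > 0; q ≤ 0 is the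
  -- bound 9k₁ ≤ 9r + rn. In terms of characters: nonprincipal ones take the values 0 or -n on E,
  -- and k₁ - r is the average of the nine characters trivial on H, among which the principal one
  -- contributes rn.
  identity-fibre-bound : ∀ (r M : ℕ) {N W k₁} → N ≡ + 3 * + M → W ≡ + M * + M →
    + 9 * (k₁ * k₁) + (- (+ 6 * (+ r * + M)) * k₁ + + r * + M * (+ r * + M) * 1ℤ)
      ≤ + 9 * (W * (+ r * + r + + r) + (+ r + + r - N) * k₁ + (+ r * (N + 1ℤ) - (+ r * + r + + r)))
          + (- (+ 6 * (+ r * + M)) * (+ r * (N + 1ℤ)) + + r * + M * (+ r * + M) * + 9) →
    0ℤ ≤ + 9 * + r + + r * N - + 9 * k₁
  identity-fibre-bound r M {k₁ = k₁} ≡.refl ≡.refl le =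
    subst (0ℤ ≤_) (linear (+ r) (+ M) k₁) (0≤* {+ 3} (ℤ.+≤+ z≤n)
      (ℤ.i≤j⇒0≤j-i (nonpositive (+ 3 * k₁ - + 3 * + r - + r * + M)
        (subst (0ℤ ≤_) (factorised (+ r) (+ M) k₁) (ℤ.i≤j⇒0≤j-i le)))))
    where
    linear : ∀ r M k₁ → + 3 * (0ℤ - (+ 3 * k₁ - + 3 * r - r * M)) ≡ + 9 * r + r * (+ 3 * M) - + 9 * k₁
    linear = ℤ-Solver.solve-∀
    factorised : ∀ r M k₁ →
      + 9 * (M * M * (r * r + r) + (r + r - + 3 * M) * k₁ + (r * (+ 3 * M + 1ℤ) - (r * r + r)))
        + (- (+ 6 * (r * M)) * (r * (+ 3 * M + 1ℤ)) + r * M * (r * M) * + 9)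
        - (+ 9 * (k₁ * k₁) + (- (+ 6 * (r * M)) * k₁ + r * M * (r * M) * 1ℤ))
      ≡ - ((+ 3 * k₁ - + 3 * r - r * M) * ((+ 3 * k₁ - + 3 * r - r * M) + + 9 * M))
    factorised = ℤ-Solver.solve-∀
    nonpositive : ∀ q → 0ℤ ≤ - (q * (q + + 9 * + M)) → q ≤ 0ℤ
    nonpositive (+ zero)  _  = ℤ.≤-refl
    nonpositive -[1+ _ ]  _  = ℤ.-≤+
    nonpositive (+ suc s) le = contradiction
      (subst (λ t → 0ℤ ≤ - (+ suc s * (+ suc s + t))) (≡.sym (ℤ.pos-* 9 M)) le) λ ()

  -- Eliminating s and k₁ and discarding f leaves a quadratic in x, which for t = n - 2r - 4 ≥ 0 and
  -- r = r′ + 1 equals -Q - 1 with Q ≥ 0. The threshold is where the argument stops: at n = 2r + 3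
  -- the same quadratic is x (3 - x), which is nonnegative for x from 0 to 3.
  moments-incompatible : ∀ (n r : ℕ) {x k₁ s f} → 1 ℕ.≤ r → 4 ℕ.+ 2 ℕ.* r ℕ.≤ n →
    0ℤ ≤ x → 0ℤ ≤ f → s ≤ k₁ → 0ℤ ≤ + 9 * + r + + r * + n - + 9 * k₁ →
    ¬ (1ℤ * (x * x) + (- + 6 * x + + 9 * f)
         ≤ 1ℤ * (+ 9 * (+ r * + r + + r) + (+ r + + r - + n) * x + (+ r * (+ n + 1ℤ) - (+ r * + r + + r)))
             + (- + 6 * (+ r * (+ n + 1ℤ)) + + 9 * s))
  moments-incompatible n r@(suc r′) {x} {k₁} {s} {f} (s≤s _) 2r+4≤n 0≤x 0≤f s≤k₁ bound le =
    ℤ.<⇒≱ ℤ.-<+ (subst (0ℤ ≤_) (eliminate Q) (0≤+ 0≤Q (subst (0ℤ ≤_) combined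
      (0≤+ (0≤+ (ℤ.i≤j⇒0≤j-i le) (0≤* {+ 9} (ℤ.+≤+ z≤n) (ℤ.i≤j⇒0≤j-i s≤k₁)))
           (0≤+ (0≤* {+ 9} (ℤ.+≤+ z≤n) 0≤f) bound)))))
    where
    t : ℕ
    t = n ℕ.∸ (4 ℕ.+ 2 ℕ.* r)
    n≡ : + n ≡ + 4 + + 2 * (1ℤ + + r′) + + t
    n≡ = ≡.trans (cong +_ (≡.sym (ℕ.m+[n∸m]≡n 2r+4≤n))) (cong (λ u → + 4 + u + + t) (ℤ.pos-* 2 r))
    Q : ℤ
    Q = (x - 1ℤ) * (x - 1ℤ) + (+ t * x + (+ 4 * + r′ * (1ℤ + + t) + + 4 * + t + + 2))
    eliminate : ∀ q → q + (- q - 1ℤ) ≡ - 1ℤ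
    eliminate = ℤ-Solver.solve-∀
    polynomial : ∀ N r x k₁ f s → 1ℤ * (+ 9 * (r * r + r) + (r + r - N) * x + (r * (N + 1ℤ) - (r * r + r)))
                     + (- + 6 * (r * (N + 1ℤ)) + + 9 * s) - (1ℤ * (x * x) + (- + 6 * x + + 9 * f))
                   + + 9 * (k₁ - s) + (+ 9 * f + (+ 9 * r + r * N - + 9 * k₁))
                 ≡ + 8 * r * r + + 12 * r - + 4 * r * N + (r + r - N) * x - x * x + + 6 * x
    polynomial = ℤ-Solver.solve-∀
    substituted : ∀ r′ t x → + 8 * (1ℤ + r′) * (1ℤ + r′) + + 12 * (1ℤ + r′) - + 4 * (1ℤ + r′) * (+ 4 + + 2 * (1ℤ + r′) + t)
                    + ((1ℤ + r′) + (1ℤ + r′) - (+ 4 + + 2 * (1ℤ + r′) + t)) * x - x * x + + 6 * x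
                  ≡ - ((x - 1ℤ) * (x - 1ℤ) + (t * x + (+ 4 * r′ * (1ℤ + t) + + 4 * t + + 2))) - 1ℤ
    substituted = ℤ-Solver.solve-∀
    combined : 1ℤ * (+ 9 * (+ r * + r + + r) + (+ r + + r - + n) * x + (+ r * (+ n + 1ℤ) - (+ r * + r + + r)))
                 + (- + 6 * (+ r * (+ n + 1ℤ)) + + 9 * s) - (1ℤ * (x * x) + (- + 6 * x + + 9 * f))
               + + 9 * (k₁ - s) + (+ 9 * f + (+ 9 * + r + + r * + n - + 9 * k₁))
               ≡ - Q - 1ℤ
    combined = ≡.trans (polynomial (+ n) (+ r) x k₁ f s)
      (≡.trans (cong (λ N → + 8 * + r * + r + + 12 * + r - + 4 * + r * N + (+ r + + r - N) * x - x * x + + 6 * x) n≡)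
        (substituted (+ r′) (+ t) x))
    0≤Q : 0ℤ ≤ Q
    0≤Q = 0≤+ (0≤i*i (x - 1ℤ)) (0≤+ (0≤* {+ t} (ℤ.+≤+ z≤n) 0≤x)
      (0≤+ (0≤+ (0≤* (0≤* {+ 4} {+ r′} (ℤ.+≤+ z≤n) (ℤ.+≤+ z≤n)) (ℤ.+≤+ z≤n)) (0≤* {+ 4} {+ t} (ℤ.+≤+ z≤n) (ℤ.+≤+ z≤n))) (ℤ.+≤+ z≤n)))

  -- The group-ring equation of a negative Latin square type PDS

  module NegativeLatinSquare {v : ℕ} {_∙_ : Op₂ (Fin v)} {ε : Fin v} {_⁻¹ : Op₁ (Fin v)}
    (isAbelianGroup : IsAbelianGroup _≡_ _∙_ ε _⁻¹) (D : Subset v) {n r : ℕ}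
    (isPDS : IsNLSPDS _∙_ ε _⁻¹ D n r) (v≡n² : v ≡ n ℕ.* n) (2r<n : 2 ℕ.* r ℕ.+ 1 ℕ.≤ n) where

    open FiniteAbelianGroup isAbelianGroup
    open PowerMap isAbelianGroup
    open GroupRing ℤ.+-*-commutativeRing using (push; _⊛_)

    d : Fin v → ℤ
    d y = 𝟙 (y ∈? D)

    -- β is λ - μ.
    k μ β : ℤ
    k = + r * (+ n + 1ℤ)
    μ = + r * + r + + r
    β = + r + + r - + n

    sum-d : sum d ≡ k
    sum-d = ≡.trans (≡.sym (∣∣≡sum D)) (≡.trans (cong +_ (proj₁ isPDS)) (ℤ.pos-* r (n ℕ.+ 1)))

    differences : Fin v → ℤ
    differences x = sum (λ g → d g * d (x \\ g))

    -- Entries with quotient x ≠ ε are distinct, and g determines h. At ε the two sides part: the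
    -- diagonal pairs, which `diffCount` omits, make `differences ε` equal to k.
    diffCount≡ : ∀ x → x ≢ ε → + diffCount _∙_ _⁻¹ D x ≡ differences x
    diffCount≡ x x≢ε = ≡.trans (count-allPairs v _) (sum-cong-≗ {v} (λ g → begin
      sum (λ h → 𝟙 ((g ∈? D) ×-dec ((h ∈? D) ×-dec (¬? (g ≟ h) ×-dec ((g ∙ (h ⁻¹)) ≟ x)))))
        ≡⟨ sum-cong-≗ {v} (λ h → ≡.trans
             (𝟙-cong ((g ∈? D) ×-dec ((h ∈? D) ×-dec (¬? (g ≟ h) ×-dec ((g ∙ (h ⁻¹)) ≟ x))))
                     ((h ≟ (x \\ g)) ×-dec ((g ∈? D) ×-dec (h ∈? D)))
                (λ (gD , hD , _ , eq) → ≡.sym (∙⇒\\ (to eq)) , gD , hD)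
                (λ (eq , gD , hD) → gD , hD , distinct eq , from eq))
             (≡.trans (𝟙-× (h ≟ (x \\ g)) ((g ∈? D) ×-dec (h ∈? D)))
                      (cong (𝟙 (h ≟ (x \\ g)) *_) (𝟙-× (g ∈? D) (h ∈? D))))) ⟩
      sum (λ h → 𝟙 (h ≟ (x \\ g)) * (d g * d h)) ≡⟨ sum-𝟙 (x \\ g) (λ h → d g * d h) ⟩
      d g * d (x \\ g) ∎))
      where
      open ≡-Reasoning
      to : ∀ {g h} → g ∙ (h ⁻¹) ≡ x → g ≡ x ∙ h
      to {g} {h} eq = ≡.trans (≡.sym (//-rightDividesˡ h g)) (cong (_∙ h) eq)
      from : ∀ {g h} → h ≡ x \\ g → g ∙ (h ⁻¹) ≡ x
      from {g} {h} eq = ≡.trans (cong (_∙ (h ⁻¹)) (\\⇒∙ (≡.sym eq))) (//-rightDividesʳ h x)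
      distinct : ∀ {g h} → h ≡ x \\ g → g ≢ h
      distinct {g} {h} eq ≡.refl = x≢ε (identityˡ-unique x g (≡.sym (\\⇒∙ (≡.sym eq))))

    differences-≢ε : ∀ x → x ≢ ε → differences x ≡ μ + β * d x
    differences-≢ε x x≢ε with x ∈? D
    ... | yes x∈D = ≡.trans (≡.sym (diffCount≡ x x≢ε)) (≡.trans (proj₁ (proj₂ isPDS x x≢ε) x∈D) lam)
      where
      lam : - (+ n) + + (r ℕ.* r ℕ.+ 3 ℕ.* r) ≡ μ + β * 1ℤ
      lam = ≡.trans (cong₂ (λ a b → - (+ n) + (a + b)) (ℤ.pos-* r r) (ℤ.pos-* 3 r)) (eq (+ n) (+ r))
        where
        eq : ∀ n r → - n + (r * r + + 3 * r) ≡ (r * r + r) + (r + r - n) * 1ℤ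
        eq = ℤ-Solver.solve-∀
    ... | no x∉D  = ≡.trans (≡.sym (diffCount≡ x x≢ε)) (≡.trans (proj₂ (proj₂ isPDS x x≢ε) x∉D) mu)
      where
      mu : + (r ℕ.* r ℕ.+ r) ≡ μ + β * 0ℤ
      mu = ≡.trans (cong (λ a → a + + r) (ℤ.pos-* r r))
        (≡.sym (≡.trans (cong (λ t → μ + t) (ℤ.*-zeroʳ β)) (ℤ.+-identityʳ μ)))

    differences-ε : differences ε ≡ k
    differences-ε = ≡.trans (sum-cong-≗ {v} (λ g → ≡.trans (cong (λ h → d g * d h) (∙⇒\\ (≡.sym (identityˡ g))))
      (𝟙-idem (g ∈? D)))) sum-d

    sum-differences : sum differences ≡ k * k
    sum-differences = begin
      sum (λ x → sum (λ g → d g * d (x \\ g)))  ≡⟨ ∑-comm (λ x g → d g * d (x \\ g)) ⟩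
      sum (λ g → sum (λ x → d g * d (x \\ g)))  ≡⟨ sum-cong-≗ {v} (λ g → *-distribˡ-sum (d g) (λ x → d (x \\ g))) ⟨
      sum (λ g → d g * sum (λ x → d (x \\ g)))  ≡⟨ sum-cong-≗ {v} (λ g → cong (d g *_)
                                                     (≡.trans (≡.sym (∑-permute d (involution (_\\ g) (\\-involutive g)))) sum-d)) ⟩
      sum (λ g → d g * k)                       ≡⟨ *-distribʳ-sum k d ⟨
      sum d * k                                 ≡⟨ cong (_* k) sum-d ⟩
      k * k                                     ∎
      where open ≡-Reasoning

    sum-affine : ∀ (w f : Fin v → ℤ) a b c →
      sum (λ x → w x * ((a + b * f x) + 𝟙 (x ≟ ε) * c)) ≡ sum w * a + b * sum (λ x → w x * f x) + w ε * c
    sum-affine w f a b c = begin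
      sum (λ x → w x * ((a + b * f x) + 𝟙 (x ≟ ε) * c))
        ≡⟨ sum-cong-≗ {v} (λ x → expand (w x) (f x) a b c (𝟙 (x ≟ ε))) ⟩
      sum (λ x → w x * a + (b * (w x * f x) + 𝟙 (x ≟ ε) * (w x * c)))
        ≡⟨ ∑-distrib-+ (λ x → w x * a) (λ x → b * (w x * f x) + 𝟙 (x ≟ ε) * (w x * c)) ⟩
      sum (λ x → w x * a) + sum (λ x → b * (w x * f x) + 𝟙 (x ≟ ε) * (w x * c))
        ≡⟨ cong (λ s → sum (λ x → w x * a) + s)
             (∑-distrib-+ (λ x → b * (w x * f x)) (λ x → 𝟙 (x ≟ ε) * (w x * c))) ⟩
      sum (λ x → w x * a) + (sum (λ x → b * (w x * f x)) + sum (λ x → 𝟙 (x ≟ ε) * (w x * c)))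
        ≡⟨ cong₂ _+_ (≡.sym (*-distribʳ-sum a w))
             (cong₂ _+_ (≡.sym (*-distribˡ-sum b (λ x → w x * f x))) (sum-𝟙 ε (λ x → w x * c))) ⟩
      sum w * a + (b * sum (λ x → w x * f x) + w ε * c)
        ≡⟨ ℤ.+-assoc (sum w * a) _ _ ⟨
      sum w * a + b * sum (λ x → w x * f x) + w ε * c ∎
      where
      open ≡-Reasoning
      expand : ∀ w f a b c e → w * ((a + b * f) + e * c) ≡ w * a + (b * (w * f) + e * (w * c))
      expand = ℤ-Solver.solve-∀

    β≢0 : β ≢ 0ℤ
    β≢0 β≡0 = ℕ.<-irrefl (≡.sym n≡2r) (subst (ℕ._≤ n) (ℕ.+-comm (2 ℕ.* r) 1) 2r<n)
      where
      n≡2r : n ≡ 2 ℕ.* r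
      n≡2r = ≡.trans (ℤ.+-injective (≡.sym (ℤ.i-j≡0⇒i≡j (+ r + + r) (+ n) β≡0)))
        (cong (r ℕ.+_) (≡.sym (ℕ.+-identityʳ r)))

    β-cancel : ∀ {a b} → β * a ≡ β * b → a ≡ b
    β-cancel {a} {b} = ℤ.*-cancelˡ-≡ β a b {{ℤ.≢-nonZero β≢0}}

    -- The definition of a PDS leaves membership of ε open. Counting all k² quotients by value, with
    -- k of them at ε, gives β · d ε = 0 for the negative Latin square parameters, and β is nonzero
    -- because 2r < n.
    d-ε : d ε ≡ 0ℤ
    d-ε = β-cancel (begin
      β * d ε                  ≡⟨ rearrange (+ v * μ + β * k) (k - μ) (k * k) (β * d ε) total ⟩
      + v * μ + β * k + (k - μ) - k * k ≡⟨ cong (λ u → u * μ + β * k + (k - μ) - k * k)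
                                             (≡.trans (cong +_ v≡n²) (ℤ.pos-* n n)) ⟩
      + n * + n * μ + β * k + (k - μ) - k * k ≡⟨ parameters (+ n) (+ r) ⟩
      0ℤ                       ≡⟨ ℤ.*-zeroʳ β ⟨
      β * 0ℤ                   ∎)
      where
      open ≡-Reasoning
      rearrange : ∀ a b s t → s ≡ a + (b - t) → t ≡ a + b - s
      rearrange a b s t ≡.refl = eq a b t
        where
        eq : ∀ a b t → t ≡ a + b - (a + (b - t))
        eq = ℤ-Solver.solve-∀
      parameters : ∀ n r → n * n * (r * r + r) + (r + r - n) * (r * (n + 1ℤ)) + (r * (n + 1ℤ) - (r * r + r))
                             - r * (n + 1ℤ) * (r * (n + 1ℤ)) ≡ 0ℤ
      parameters = ℤ-Solver.solve-∀
      γ : ℤ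
      γ = k - μ - β * d ε
      pointwise : ∀ x → differences x ≡ 1ℤ * ((μ + β * d x) + 𝟙 (x ≟ ε) * γ)
      pointwise x with x ≟ ε
      ... | yes ≡.refl = ≡.trans differences-ε (eq k μ (β * d ε))
        where
        eq : ∀ k m t → k ≡ 1ℤ * ((m + t) + 1ℤ * (k - m - t))
        eq = ℤ-Solver.solve-∀
      ... | no x≢ε = ≡.trans (differences-≢ε x x≢ε) (≡.sym (≡.trans (ℤ.*-identityˡ _) (ℤ.+-identityʳ _)))
      total : k * k ≡ (+ v * μ + β * k) + ((k - μ) - β * d ε)
      total = begin
        k * k                                                    ≡⟨ sum-differences ⟨
        sum differences                                          ≡⟨ sum-cong-≗ {v} pointwise ⟩
        sum (λ x → 1ℤ * ((μ + β * d x) + 𝟙 (x ≟ ε) * γ))         ≡⟨ sum-affine (λ _ → 1ℤ) d μ β γ ⟩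
        sum {v} (λ _ → 1ℤ) * μ + β * sum (λ x → 1ℤ * d x) + 1ℤ * γ
          ≡⟨ cong₂ _+_ (cong₂ _+_ (cong (_* μ) (sum-1 v))
               (cong (β *_) (≡.trans (sum-cong-≗ {v} (λ x → ℤ.*-identityˡ (d x))) sum-d))) (ℤ.*-identityˡ γ) ⟩
        (+ v * μ + β * k) + γ ∎

    differences≡ : ∀ x → differences x ≡ (μ + β * d x) + 𝟙 (x ≟ ε) * (k - μ)
    differences≡ x with x ≟ ε
    ... | no x≢ε     = ≡.trans (differences-≢ε x x≢ε) (≡.sym (ℤ.+-identityʳ _))
    ... | yes ≡.refl = ≡.trans differences-ε (≡.trans (eq k μ β) (cong (λ t → (μ + β * t) + 1ℤ * (k - μ)) (≡.sym d-ε)))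
      where
      eq : ∀ k m b → k ≡ (m + b * 0ℤ) + 1ℤ * (k - m)
      eq = ℤ-Solver.solve-∀

    differences-⁻¹ : ∀ x → differences (x ⁻¹) ≡ differences x
    differences-⁻¹ x = begin
      sum (λ g → d g * d ((x ⁻¹) \\ g))                 ≡⟨ ∑-permute (λ g → d g * d ((x ⁻¹) \\ g)) (translation (x ⁻¹)) ⟩
      sum (λ g → d (x \\ g) * d ((x ⁻¹) \\ (x \\ g)))   ≡⟨ sum-cong-≗ {v} (λ g → ≡.trans
                                                             (cong (λ h → d (x \\ g) * d h) (\\-leftDividesʳ (x ⁻¹) g))
                                                             (ℤ.*-comm (d (x \\ g)) (d g))) ⟩
      sum (λ g → d g * d (x \\ g))                      ∎
      where open ≡-Reasoning

    -- Exchanging g and h inverts a quotient, so x and its inverse are represented equally often;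
    -- since λ ≠ μ, the number of representations reveals membership in D.
    d-⁻¹ : ∀ x → d (x ⁻¹) ≡ d x
    d-⁻¹ x with x ≟ ε
    ... | yes ≡.refl = cong d ε⁻¹≈ε
    ... | no x≢ε = β-cancel (∙-cancelˡ μ (β * d (x ⁻¹)) (β * d x) (≡.trans (≡.sym (differences-≢ε (x ⁻¹) x⁻¹≢ε))
                     (≡.trans (differences-⁻¹ x) (differences-≢ε x x≢ε))))
      where
      open import Algebra.Properties.Group (CommutativeRing.+-group ℤ.+-*-commutativeRing) using (∙-cancelˡ)
      x⁻¹≢ε : x ⁻¹ ≢ ε
      x⁻¹≢ε eq = x≢ε (⁻¹-injective (≡.trans eq (≡.sym ε⁻¹≈ε)))

    d⊛d : ∀ x → (d ⊛ d) x ≡ (μ + β * d x) + 𝟙 (x ≟ ε) * (k - μ)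
    d⊛d x = ≡.trans (sum-cong-≗ {v} (λ y → cong (d y *_) (≡.trans (≡.sym (d-⁻¹ (y \\ x))) (cong d (⁻¹-anti-homo-\\ y x)))))
      (differences≡ x)

    -- The shift r is a root of X² = βX + (k - μ), the other root being r - n. Subtracting it
    -- removes the identity term from D² = (k - μ)ε + βD + μG, and the two roots become 0 and -n.
    e : Fin v → ℤ
    e y = d y - 𝟙 (y ≟ ε) * + r

    e-≢ε : ∀ {y} → y ≢ ε → e y ≡ d y
    e-≢ε {y} y≢ε = ≡.trans (cong (λ t → d y - t * + r) (𝟙-no (y ≟ ε) y≢ε)) (ℤ.+-identityʳ (d y))

    sum-e : sum e ≡ + r * + n
    sum-e = begin
      sum (λ y → d y - 𝟙 (y ≟ ε) * + r)          ≡⟨ sum-cong-≗ {v} (λ y → cong (λ t → d y + t)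
                                                      (ℤ.neg-distribʳ-* (𝟙 (y ≟ ε)) (+ r))) ⟩
      sum (λ y → d y + 𝟙 (y ≟ ε) * - (+ r))      ≡⟨ ∑-distrib-+ d (λ y → 𝟙 (y ≟ ε) * - (+ r)) ⟩
      sum d + sum (λ y → 𝟙 (y ≟ ε) * - (+ r))    ≡⟨ cong₂ _+_ sum-d (sum-𝟙 ε (λ _ → - (+ r))) ⟩
      k + - (+ r)                                ≡⟨ eq (+ n) (+ r) ⟩
      + r * + n                                  ∎
      where
      open ≡-Reasoning
      eq : ∀ n r → r * (n + 1ℤ) + - r ≡ r * n
      eq = ℤ-Solver.solve-∀

    e⊛e : ∀ x → (e ⊛ e) x ≡ μ - + n * e x
    e⊛e x = begin
      sum (λ y → (d y - 𝟙 (y ≟ ε) * + r) * e (y \\ x))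
        ≡⟨ sum-cong-≗ {v} (λ y → left (d y) (𝟙 (y ≟ ε)) (+ r) (e (y \\ x))) ⟩
      sum (λ y → d y * e (y \\ x) + 𝟙 (y ≟ ε) * - (+ r * e (y \\ x)))
        ≡⟨ ∑-distrib-+ (λ y → d y * e (y \\ x)) (λ y → 𝟙 (y ≟ ε) * - (+ r * e (y \\ x))) ⟩
      sum (λ y → d y * e (y \\ x)) + sum (λ y → 𝟙 (y ≟ ε) * - (+ r * e (y \\ x)))
        ≡⟨ cong₂ _+_ d⊛e (≡.trans (sum-𝟙 ε (λ y → - (+ r * e (y \\ x))))
             (cong (λ z → - (+ r * e z)) (∙⇒\\ (≡.sym (identityˡ x))))) ⟩
      ((d ⊛ d) x + - (d x * + r)) + - (+ r * e x)
        ≡⟨ cong (λ t → (t + - (d x * + r)) + - (+ r * e x)) (d⊛d x) ⟩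
      (((μ + β * d x) + 𝟙 (x ≟ ε) * (k - μ)) + - (d x * + r)) + - (+ r * e x)
        ≡⟨ parameters (+ n) (+ r) (d x) (𝟙 (x ≟ ε)) ⟩
      μ - + n * e x ∎
      where
      open ≡-Reasoning
      left : ∀ a b r c → (a - b * r) * c ≡ a * c + b * - (r * c)
      left = ℤ-Solver.solve-∀
      right : ∀ a b r c → a * (c - b * r) ≡ a * c + b * - (a * r)
      right = ℤ-Solver.solve-∀
      parameters : ∀ n r d t → ((((r * r + r) + (r + r - n) * d) + t * (r * (n + 1ℤ) - (r * r + r))) + - (d * r))
                                 + - (r * (d - t * r)) ≡ (r * r + r) - n * (d - t * r)
      parameters = ℤ-Solver.solve-∀
      d⊛e : sum (λ y → d y * e (y \\ x)) ≡ (d ⊛ d) x + - (d x * + r)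
      d⊛e = begin
        sum (λ y → d y * (d (y \\ x) - 𝟙 (y \\ x ≟ ε) * + r))
          ≡⟨ sum-cong-≗ {v} (λ y → ≡.trans (right (d y) (𝟙 (y \\ x ≟ ε)) (+ r) (d (y \\ x)))
               (cong (λ t → d y * d (y \\ x) + t * - (d y * + r)) (𝟙-cong (y \\ x ≟ ε) (y ≟ x)
                  (λ eq → ≡.sym (≡.trans (\\⇒∙ eq) (identityʳ y)))
                  (λ eq → ∙⇒\\ (≡.trans (≡.sym eq) (≡.sym (identityʳ y))))))) ⟩
        sum (λ y → d y * d (y \\ x) + 𝟙 (y ≟ x) * - (d y * + r))
          ≡⟨ ∑-distrib-+ (λ y → d y * d (y \\ x)) (λ y → 𝟙 (y ≟ x) * - (d y * + r)) ⟩
        (d ⊛ d) x + sum (λ y → 𝟙 (y ≟ x) * - (d y * + r))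
          ≡⟨ cong (λ t → (d ⊛ d) x + t) (sum-𝟙 x (λ y → - (d y * + r))) ⟩
        (d ⊛ d) x + - (d x * + r) ∎

    -- Powers of E modulo a prime, and multipliers

    module Modulo {p : ℕ} (p-prime : Prime p) where
      open Congruence (+ p) using (≡⇒≈; congruent; k∣a-b)
      open CommutativeRing (ℤ/ (+ p)) using (_≈_; refl; trans; sym; semiring; *-congʳ; +-cong; +-congˡ; +-group)
      open import Algebra.Properties.Semiring.Exp semiring using (_^_)
      open import Algebra.Properties.Group +-group using () renaming (identityʳ-unique to +-identityʳ-unique)
      private
        module M = GroupRing (ℤ/ (+ p))
        module MR = CommutativeRing M.groupRing

      frobenius-e : ∀ x → (e M.⊛^ p) x ≈ push p e x
      frobenius-e = M.frobenius p-prime (ModPrime.characteristic p-prime) (ModPrime.fermat p-prime) e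

      -- The coefficient of the all-one function G in the power j + 1 of E. The recursion comes from
      -- E² = -nE + μG together with E·G = (Σ e)·G.
      constant : ℕ → ℤ
      constant zero    = 0ℤ
      constant (suc j) = (- (+ n)) ^ j * μ + constant j * sum e

      e-power : ∀ j x → (e M.⊛^ suc j) x ≈ (- (+ n)) ^ j * e x + constant j
      e-power zero    x = trans (MR.*-identityʳ e x)
        (≡⇒≈ (≡.sym (≡.trans (ℤ.+-identityʳ _) (ℤ.*-identityˡ (e x)))))
      e-power (suc j) x = trans (M.⊛-cong {f = e} (λ _ → refl) (e-power j) x) (≡⇒≈ (begin
        sum (λ y → e y * (u * e (y \\ x) + c))
          ≡⟨ sum-cong-≗ {v} (λ y → expand (e y) u (e (y \\ x)) c) ⟩
        sum (λ y → u * (e y * e (y \\ x)) + c * e y)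
          ≡⟨ ∑-distrib-+ (λ y → u * (e y * e (y \\ x))) (λ y → c * e y) ⟩
        sum (λ y → u * (e y * e (y \\ x))) + sum (λ y → c * e y)
          ≡⟨ cong₂ _+_ (≡.sym (*-distribˡ-sum u (λ y → e y * e (y \\ x)))) (≡.sym (*-distribˡ-sum c e)) ⟩
        u * (e ⊛ e) x + c * sum e
          ≡⟨ cong (λ t → u * t + c * sum e) (e⊛e x) ⟩
        u * (μ - + n * e x) + c * sum e
          ≡⟨ collect u μ (+ n) (e x) (c * sum e) ⟩
        - (+ n) * u * e x + (u * μ + c * sum e) ∎))
        where
        open ≡-Reasoning
        u c : ℤ
        u = (- (+ n)) ^ j
        c = constant j
        expand : ∀ a u b c → a * (u * b + c) ≡ u * (a * b) + c * a
        expand = ℤ-Solver.solve-∀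
        collect : ∀ u m n e s → u * (m - n * e) + s ≡ - n * u * e + (u * m + s)
        collect = ℤ-Solver.solve-∀

      1<p : 1 ℕ.< p
      1<p = ℕ.nonTrivial⇒n>1 p {{prime⇒nonTrivial p-prime}}

      fermat-unit : ¬ (p ∣ n) → ∀ q → suc q ≡ p → (- (+ n)) ^ q ≈ 1ℤ
      fermat-unit p∤n q ≡.refl with euclidsLemma n ∣ (- (+ n)) ^ q - 1ℤ ∣ p-prime p∣product
        where
        product≡ : (- (+ n)) ^ suc q - - (+ n) ≡ - (+ n) * ((- (+ n)) ^ q - 1ℤ)
        product≡ = eq (- (+ n)) ((- (+ n)) ^ q)
          where
          eq : ∀ a b → a * b - a ≡ a * (b - 1ℤ)
          eq = ℤ-Solver.solve-∀
        p∣product : p ∣ n ℕ.* ∣ (- (+ n)) ^ q - 1ℤ ∣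
        p∣product = subst (p ∣_) (≡.trans (cong ∣_∣ product≡) (≡.trans (ℤ.abs-* (- (+ n)) _)
            (cong (ℕ._* ∣ (- (+ n)) ^ q - 1ℤ ∣) (ℤ.∣-i∣≡∣i∣ (+ n)))))
          (ℤ∣.∣⇒∣ᵤ (k∣a-b (ModPrime.fermat p-prime (- (+ n)))))
      ... | inj₁ p∣n = contradiction p∣n p∤n
      ... | inj₂ p∣u = congruent (ℤ∣.∣ᵤ⇒∣ p∣u)

      𝟙-≈⇒≡ : ∀ {a b} {P : Set a} {Q : Set b} (P? : Dec P) (Q? : Dec Q) → 𝟙 P? ≈ 𝟙 Q? → 𝟙 P? ≡ 𝟙 Q?
      𝟙-≈⇒≡ (yes _) (yes _) _  = ≡.refl
      𝟙-≈⇒≡ (no _)  (no _)  _  = ≡.refl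
      𝟙-≈⇒≡ (yes _) (no _)  eq = contradiction (ℕ∣.∣⇒≤ (ℤ∣.∣⇒∣ᵤ (k∣a-b eq))) (ℕ.<⇒≱ 1<p)
      𝟙-≈⇒≡ (no _)  (yes _) eq = contradiction (ℕ∣.∣⇒≤ (ℤ∣.∣⇒∣ᵤ (k∣a-b eq))) (ℕ.<⇒≱ 1<p)

      -- As p is coprime to v, `pow p` permutes the group and (-n)^(p - 1) ≡ 1, so e g ≡ e (g^p) + c
      -- modulo p with one constant c for all g. Once c vanishes, values in {0, 1} that agree modulo
      -- p are equal.
      prime-multiplier : Coprime p v → ∀ g → d (pow p g) ≡ d g
      prime-multiplier p⊥v g with g ≟ ε
      ... | yes ≡.refl = cong d (pow-ε p)
      ... | no g≢ε = ≡.sym (𝟙-≈⇒≡ (g ∈? D) (pow p g ∈? D)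
              (trans (≡⇒≈ (≡.sym (e-≢ε {g} g≢ε))) (trans (e-pow g) (≡⇒≈ (e-≢ε {pow p g} (g≢ε ∘ pow-injective-ε))))))
        where
        q : ℕ
        q = ℕ.pred p
        suc-q : suc q ≡ p
        suc-q = ℕ.suc-pred p {{prime⇒nonZero p-prime}}
        p∤n : ¬ (p ∣ n)
        p∤n p∣n = ℕ.<-irrefl (≡.sym (p⊥v (ℕ∣.∣-refl , subst (p ∣_) (≡.sym v≡n²) (ℕ∣.∣m⇒∣m*n n p∣n)))) 1<p
        injective : ∀ {x y} → pow p x ≡ pow p y → x ≡ y
        injective {x} {y} eq = pow-injective (Coprime.sym p⊥v) eq (≡.trans (lagrange x) (≡.sym (lagrange y)))
        pow-injective-ε : ∀ {y} → pow p y ≡ ε → y ≡ ε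
        pow-injective-ε eq = injective (≡.trans eq (≡.sym (pow-ε p)))
        push-pow : ∀ g → push p e (pow p g) ≡ e g
        push-pow g = ≡.trans (sum-cong-≗ {v} (λ y → cong (_* e y) (𝟙-cong (pow p g ≟ pow p y) (y ≟ g)
          (λ eq → injective (≡.sym eq)) (λ eq → cong (pow p) (≡.sym eq))))) (sum-𝟙 g e)
        c : ℤ
        c = constant q
        shifted : ∀ g → e g ≈ e (pow p g) + c
        shifted g = trans (≡⇒≈ (≡.sym (push-pow g))) (trans (sym (frobenius-e (pow p g)))
          (trans (≡⇒≈ (cong (λ j → (e M.⊛^ j) (pow p g)) (≡.sym suc-q))) (trans (e-power q (pow p g))
          (+-cong (trans (*-congʳ {e (pow p g)} (fermat-unit p∤n q suc-q)) (≡⇒≈ (ℤ.*-identityˡ _))) refl))))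
        -- The power map fixes ε, so the relation at ε forces c ≡ 0 without evaluating the
        -- recursion.
        c≈0 : c ≈ 0ℤ
        c≈0 = +-identityʳ-unique (e ε) c (trans (≡⇒≈ (cong (λ x → e x + c) (≡.sym (pow-ε p)))) (sym (shifted ε)))
        e-pow : ∀ g → e g ≈ e (pow p g)
        e-pow g = trans (shifted g) (trans (+-congˡ {e (pow p g)} c≈0) (≡⇒≈ (ℤ.+-identityʳ _)))

    multiplier : ∀ ps → All Prime ps → Coprime (product ps) v → ∀ g → d (pow (product ps) g) ≡ d g
    multiplier []       _                _    g = cong d (identityʳ g)
    multiplier (p ∷ ps) (p-prime ∷ prs) ps⊥v g = begin
      d (pow (p ℕ.* product ps) g)    ≡⟨ cong d (pow-* g p (product ps)) ⟨
      d (pow p (pow (product ps) g))  ≡⟨ Modulo.prime-multiplier p-prime (λ (a , b) → ps⊥v (ℕ∣.∣m⇒∣m*n (product ps) a , b)) _ ⟩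
      d (pow (product ps) g)          ≡⟨ multiplier ps prs (λ (a , b) → ps⊥v (ℕ∣.∣n⇒∣m*n p a , b)) g ⟩
      d g                             ∎
      where open ≡-Reasoning

    -- Multipliers compose, so the prime factors of c suffice and no prime in a prescribed residue
    -- class has to be found.
    coprime-multiplier : ∀ c → .{{NonZero c}} → Coprime c v → ∀ g → d (pow c g) ≡ d g
    coprime-multiplier c c⊥v g = ≡.trans (cong (λ j → d (pow j g)) isFactorisation)
      (multiplier factors factorsPrime (λ {i} (a , b) → c⊥v (subst (i ∣_) (≡.sym isFactorisation) a , b)) g)
      where open PrimeFactorisation (factorise c)

    -- Every coefficient of E³ is a multiple of n: E enters with n², and the all-one part acquires a
    -- factor n from -n and from Σ e = rn. So `push 3 e` already vanishes modulo 3; the second push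
    -- by 3 enlarges the kernel to the full 9-torsion. Away from ε the fibres of e and d agree.
    3∣fibre : 3 ∣ n → ∀ {z} → z ≢ ε → + 3 ∣ℤ push 9 d z
    3∣fibre 3∣n {z} z≢ε = subst (+ 3 ∣ℤ_) push-e≡push-d
      (subst (+ 3 ∣ℤ_) (≡.sym (push-* 3 3 e z)) (≈0⇒∣ (push-≈0 (push 3 e) push-e≈0 z)))
      where
      open Modulo prime[3]
      open Congruence (+ 3) using (≡⇒≈; ∣⇒≈0; ≈0⇒∣)
      open CommutativeRing (ℤ/ (+ 3)) using (_≈_; trans; sym; *-congˡ; semiring)
      module ∑₃ where
        open import Algebra.Properties.Semiring.Sum semiring public
      factor : ∀ n m r x → - n * (- n * 1ℤ) * x + (- n * 1ℤ * m + (1ℤ * m + 0ℤ * (r * n)) * (r * n)) ≡ n * (n * x - m + m * r)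
      factor = ℤ-Solver.solve-∀
      push-e≈0 : ∀ x → push 3 e x ≈ 0ℤ
      push-e≈0 x = trans (sym (frobenius-e x)) (trans (e-power 2 x) (∣⇒≈0 (subst (+ 3 ∣ℤ_)
        (≡.sym (≡.trans (cong (λ s → - (+ n) * (- (+ n) * 1ℤ) * e x + (- (+ n) * 1ℤ * μ + (1ℤ * μ + 0ℤ * s) * s)) sum-e)
                        (factor (+ n) μ (+ r) (e x))))
        (ℤ∣.∣m⇒∣m*n {m = + n} _ (ℤ∣.∣ᵤ⇒∣ 3∣n)))))
      push-≈0 : ∀ f → (∀ x → f x ≈ 0ℤ) → ∀ z → push 3 f z ≈ 0ℤ
      push-≈0 f f≈0 z = trans (∑₃.sum-cong-≋ {v} (λ y → trans (*-congˡ {𝟙 (z ≟ pow 3 y)} (f≈0 y)) (≡⇒≈ (ℤ.*-zeroʳ (𝟙 (z ≟ pow 3 y))))))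
        (∑₃.sum-replicate-zero v)
      push-e≡push-d : push 9 e z ≡ push 9 d z
      push-e≡push-d = sum-cong-≗ {v} term
        where
        term : ∀ y → 𝟙 (z ≟ pow 9 y) * e y ≡ 𝟙 (z ≟ pow 9 y) * d y
        term y = 𝟙-guard (z ≟ pow 9 y) λ eq → e-≢ε {y} λ { ≡.refl → z≢ε (≡.trans eq (pow-ε 9)) }

    -- D² is summed over the kernel by `push-square`; the identity, which always lies in the kernel,
    -- accounts for k - μ.
    second-moment : ∀ q → sum (λ z → push q d z * push q d z) ≡ ∣ker q ∣ * μ + β * push q d ε + (k - μ)
    second-moment q = begin
      sum (λ z → push q d z * push q d z)                  ≡⟨ push-square q d d-⁻¹ ⟩
      sum (λ x → ker q x * (d ⊛ d) x)                      ≡⟨ sum-cong-≗ {v} (λ x → cong (ker q x *_) (d⊛d x)) ⟩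
      sum (λ x → ker q x * ((μ + β * d x) + 𝟙 (x ≟ ε) * (k - μ)))
        ≡⟨ sum-affine (ker q) d μ β (k - μ) ⟩
      ∣ker q ∣ * μ + β * sum (λ x → ker q x * d x) + ker q ε * (k - μ)
        ≡⟨ cong₂ (λ s t → ∣ker q ∣ * μ + β * s + t) (≡.sym (push-ε q d))
             (≡.trans (cong (_* (k - μ)) (𝟙-yes (pow q ε ≟ ε) (pow-ε q))) (ℤ.*-identityˡ (k - μ))) ⟩
      ∣ker q ∣ * μ + β * push q d ε + (k - μ)              ∎
      where open ≡-Reasoning

    -- The reflecting automorphism and the two fibre inequalities

    module Fibres {M : ℕ} .{{_ : NonZero M}} (n≡3M : n ≡ 3 ℕ.* M) (9⊥M² : Coprime 9 (M ℕ.* M))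
      (a b : ℕ) (2+aM²≡9b : 2 ℕ.+ a ℕ.* (M ℕ.* M) ≡ 9 ℕ.* b) where

      w : ℕ
      w = M ℕ.* M

      v≡9w : v ≡ 9 ℕ.* w
      v≡9w = ≡.trans v≡n² (≡.trans (cong₂ ℕ._*_ n≡3M n≡3M) (eq M))
        where
        eq : ∀ M → (3 ℕ.* M) ℕ.* (3 ℕ.* M) ≡ 9 ℕ.* (M ℕ.* M)
        eq = ℕ-Solver.solve-∀

      v≡w9 : v ≡ w ℕ.* 9
      v≡w9 = ≡.trans v≡9w (ℕ.*-comm 9 w)

      private instance
        w≢0 : NonZero w
        w≢0 = ℕ.m*n≢0 M M

      ∣ker9∣ : ∣ker 9 ∣ ≡ + 9
      ∣ker9∣ = ∣ker∣≡ {9} {w} v≡9w 9⊥M²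

      ∣kerw∣ : ∣ker w ∣ ≡ + w
      ∣kerw∣ = ∣ker∣≡ {w} {9} v≡w9 (Coprime.sym 9⊥M²)

      c : ℕ
      c = suc (a ℕ.* w)

      1+c≡9b : suc c ≡ 9 ℕ.* b
      1+c≡9b = 2+aM²≡9b

      -- A common divisor is coprime to w because c ≡ 1 (mod w), hence divides 9; it then divides
      -- both c and c + 1 = 9b.
      c⊥v : Coprime c v
      c⊥v {i} (i∣c , i∣v) = ℕ∣.∣1⇒≡1 (ℕ∣.∣m+n∣m⇒∣n (subst (i ∣_) (≡.trans (≡.sym 1+c≡9b) (ℕ.+-comm 1 c)) (ℕ∣.∣m⇒∣m*n b i∣9)) i∣c)
        where
        i⊥w : Coprime i w
        i⊥w {j} (j∣i , j∣w) = ℕ∣.∣1⇒≡1 (ℕ∣.∣m+n∣m⇒∣n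
          (subst (j ∣_) (ℕ.+-comm 1 (a ℕ.* w)) (ℕ∣.∣-trans j∣i i∣c)) (ℕ∣.∣n⇒∣m*n a j∣w))
        i∣9 : i ∣ 9
        i∣9 = coprime-divisor i⊥w (subst (i ∣_) v≡w9 i∣v)

      σ : Fin v → Fin v
      σ = pow c

      σ-involutive : ∀ y → σ (σ y) ≡ y
      σ-involutive y = begin
        pow c (pow c y)                      ≡⟨ pow-* y c c ⟩
        pow (c ℕ.* c) y                      ≡⟨ cong (λ j → pow j y) c*c≡ ⟩
        pow (1 ℕ.+ a ℕ.* b ℕ.* v) y          ≡⟨ cong (y ∙_) (pow-kernel-* (a ℕ.* b) (lagrange y)) ⟩
        y ∙ ε                                ≡⟨ identityʳ y ⟩
        y                                    ∎
        where
        open ≡-Reasoning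
        -- c² - 1 = (c - 1)(c + 1) = aw · 9b, and 9w = v.
        c*c≡ : c ℕ.* c ≡ 1 ℕ.+ a ℕ.* b ℕ.* v
        c*c≡ = begin
          c ℕ.* c                            ≡⟨ e₁ (a ℕ.* w) ⟩
          1 ℕ.+ a ℕ.* w ℕ.* suc c            ≡⟨ cong (λ t → 1 ℕ.+ a ℕ.* w ℕ.* t) 1+c≡9b ⟩
          1 ℕ.+ a ℕ.* w ℕ.* (9 ℕ.* b)        ≡⟨ e₂ a w b ⟩
          1 ℕ.+ a ℕ.* b ℕ.* (9 ℕ.* w)        ≡⟨ cong (λ t → 1 ℕ.+ a ℕ.* b ℕ.* t) v≡9w ⟨
          1 ℕ.+ a ℕ.* b ℕ.* v                ∎
          where
          e₁ : ∀ t → (1 ℕ.+ t) ℕ.* (1 ℕ.+ t) ≡ 1 ℕ.+ t ℕ.* (2 ℕ.+ t)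
          e₁ = ℕ-Solver.solve-∀
          e₂ : ∀ a w b → 1 ℕ.+ a ℕ.* w ℕ.* (9 ℕ.* b) ≡ 1 ℕ.+ a ℕ.* b ℕ.* (9 ℕ.* w)
          e₂ = ℕ-Solver.solve-∀

      σ-fibre : ∀ y → pow 9 (σ y) ≡ pow 9 y
      σ-fibre y = begin
        pow 9 (pow c y)                      ≡⟨ pow-* y 9 c ⟩
        pow (9 ℕ.* c) y                      ≡⟨ cong (λ j → pow j y) (≡.trans (eq a w) (cong (λ t → 9 ℕ.+ a ℕ.* t) (≡.sym v≡9w))) ⟩
        pow (9 ℕ.+ a ℕ.* v) y                ≡⟨ pow-+ y 9 (a ℕ.* v) ⟩
        pow 9 y ∙ pow (a ℕ.* v) y            ≡⟨ cong (pow 9 y ∙_) (pow-kernel-* a (lagrange y)) ⟩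
        pow 9 y ∙ ε                          ≡⟨ identityʳ _ ⟩
        pow 9 y                              ∎
        where
        open ≡-Reasoning
        eq : ∀ a w → 9 ℕ.* (1 ℕ.+ a ℕ.* w) ≡ 9 ℕ.+ a ℕ.* (9 ℕ.* w)
        eq = ℕ-Solver.solve-∀

      -- If σ y = y then y² = y^(c + 1) = y^(9b), so the element y^w has square y^(9bw) = ε, while
      -- its 9th power is y^v = ε. An element of odd order that is its own inverse is trivial.
      σ-fixed⇒ker : ∀ y → σ y ≡ y → pow w y ≡ ε
      σ-fixed⇒ker y σy≡y = pow-coprime (from-yes (coprime? 2 9)) 2-torsion 9-torsion
        where
        open ≡-Reasoning
        9-torsion : pow 9 (pow w y) ≡ ε
        9-torsion = ≡.trans (pow-* y 9 w) (≡.trans (cong (λ j → pow j y) (≡.sym v≡9w)) (lagrange y))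
        2-torsion : pow 2 (pow w y) ≡ ε
        2-torsion = begin
          pow 2 (pow w y)        ≡⟨ pow-* y 2 w ⟩
          pow (2 ℕ.* w) y        ≡⟨ cong (λ j → pow j y) (ℕ.*-comm 2 w) ⟩
          pow (w ℕ.* 2) y        ≡⟨ pow-* y w 2 ⟨
          pow w (pow 2 y)        ≡⟨ cong (λ t → pow w (y ∙ t)) (≡.trans (identityʳ y) (≡.sym σy≡y)) ⟩
          pow w (pow (suc c) y)  ≡⟨ pow-* y w (suc c) ⟩
          pow (w ℕ.* suc c) y    ≡⟨ cong (λ j → pow j y) (≡.trans (cong (w ℕ.*_) 1+c≡9b) (eq w b)) ⟩
          pow (b ℕ.* (9 ℕ.* w)) y ≡⟨ cong (λ j → pow (b ℕ.* j) y) v≡9w ⟨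
          pow (b ℕ.* v) y        ≡⟨ pow-kernel-* b (lagrange y) ⟩
          ε                      ∎
          where
          eq : ∀ w b → w ℕ.* (9 ℕ.* b) ≡ b ℕ.* (9 ℕ.* w)
          eq = ℕ-Solver.solve-∀

      d-fixed : Fin v → ℤ
      d-fixed y = 𝟙 (σ y ≟ y) * d y

      0≤d-fixed : ∀ y → 0ℤ ≤ d-fixed y
      0≤d-fixed y = 0≤* (0≤𝟙 (σ y ≟ y)) (0≤𝟙 (y ∈? D))

      0≤push : ∀ q {f} → (∀ y → 0ℤ ≤ f y) → ∀ z → 0ℤ ≤ push q f z
      0≤push q 0≤f z = sum-nonneg (λ y → 0≤* (0≤𝟙 (z ≟ pow q y)) (0≤f y))

      -- σ permutes the elements of D inside each fibre of `pow 9`, so those it moves pair off.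
      fibre-parity : ∀ z → ∃ λ t → push 9 d z ≡ push 9 d-fixed z + (t + t)
      fibre-parity z = Product.map₂ (λ {t} eq → ≡.trans eq (cong (λ s → s + (t + t)) reorder))
        (sum-involution σ σ-involutive f invariant)
        where
        open import Algebra.Properties.CommutativeSemigroup ℤ.*-commutativeSemigroup using (x∙yz≈y∙xz)
        f : Fin v → ℤ
        f y = 𝟙 (z ≟ pow 9 y) * d y
        invariant : ∀ y → f (σ y) ≡ f y
        invariant y = cong₂ (λ x b → 𝟙 (z ≟ x) * b) (σ-fibre y) (coprime-multiplier c c⊥v y)
        reorder : sum (λ y → 𝟙 (σ y ≟ y) * f y) ≡ push 9 d-fixed z
        reorder = sum-cong-≗ {v} (λ y → x∙yz≈y∙xz (𝟙 (σ y ≟ y)) (𝟙 (z ≟ pow 9 y)) (d y))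

      sum-quadratic : ∀ (f g h : Fin v → ℤ) s t u →
        sum (λ z → s * (f z * f z) + (t * g z + u * h z)) ≡ s * sum (λ z → f z * f z) + (t * sum g + u * sum h)
      sum-quadratic f g h s t u = begin
        sum (λ z → s * (f z * f z) + (t * g z + u * h z))
          ≡⟨ ∑-distrib-+ (λ z → s * (f z * f z)) (λ z → t * g z + u * h z) ⟩
        sum (λ z → s * (f z * f z)) + sum (λ z → t * g z + u * h z)
          ≡⟨ cong₂ _+_ (≡.sym (*-distribˡ-sum s (λ z → f z * f z))) (∑-distrib-+ (λ z → t * g z) (λ z → u * h z)) ⟩
        s * sum (λ z → f z * f z) + (sum (λ z → t * g z) + sum (λ z → u * h z))
          ≡⟨ cong (λ y → s * sum (λ z → f z * f z) + y)
               (cong₂ _+_ (≡.sym (*-distribˡ-sum t g)) (≡.sym (*-distribˡ-sum u h))) ⟩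
        s * sum (λ z → f z * f z) + (t * sum g + u * sum h) ∎
        where open ≡-Reasoning

      x k₁ : ℤ
      x  = push 9 d ε
      k₁ = push w d ε

      9-fibres : 1ℤ * (x * x) + (- + 6 * x + + 9 * push 9 d-fixed ε)
                 ≤ 1ℤ * (+ 9 * μ + β * x + (k - μ)) + (- + 6 * k + + 9 * sum d-fixed)
      9-fibres = subst (1ℤ * (x * x) + (- + 6 * x + + 9 * push 9 d-fixed ε) ≤_) total
        (sum-except ε (λ z → 1ℤ * (push 9 d z * push 9 d z) + (- + 6 * push 9 d z + + 9 * push 9 d-fixed z)) nonneg)
        where
        nonneg : ∀ z → z ≢ ε → 0ℤ ≤ 1ℤ * (push 9 d z * push 9 d z) + (- + 6 * push 9 d z + + 9 * push 9 d-fixed z)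
        nonneg z z≢ε = subst (λ t → 0ℤ ≤ t + (- + 6 * push 9 d z + + 9 * push 9 d-fixed z))
          (≡.sym (ℤ.*-identityˡ (push 9 d z * push 9 d z)))
          (fibre-inequality {push 9 d z} {push 9 d-fixed z} {proj₁ (fibre-parity z)} (proj₂ (fibre-parity z))
            (3∣fibre (ℕ∣.divides M (≡.trans n≡3M (ℕ.*-comm 3 M))) z≢ε) (0≤push 9 0≤d-fixed z))
        total : sum (λ z → 1ℤ * (push 9 d z * push 9 d z) + (- + 6 * push 9 d z + + 9 * push 9 d-fixed z))
                ≡ 1ℤ * (+ 9 * μ + β * x + (k - μ)) + (- + 6 * k + + 9 * sum d-fixed)
        total = ≡.trans (sum-quadratic (push 9 d) (push 9 d) (push 9 d-fixed) 1ℤ (- + 6) (+ 9))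
          (cong₂ (λ s t → 1ℤ * s + t)
            (≡.trans (second-moment 9) (cong (λ t → t * μ + β * x + (k - μ)) ∣ker9∣))
            (cong₂ (λ s t → - + 6 * s + + 9 * t) (≡.trans (sum-push-1 9 d) sum-d) (sum-push-1 9 d-fixed)))

      fixed≤k₁ : sum d-fixed ≤ k₁
      fixed≤k₁ = subst (sum d-fixed ≤_) (≡.sym (push-ε w d)) (sum-mono term)
        where
        term : ∀ y → 𝟙 (σ y ≟ y) * d y ≤ ker w y * d y
        term y with σ y ≟ y
        ... | yes eq = ℤ.≤-reflexive (cong (_* d y) (≡.sym (𝟙-yes (pow w y ≟ ε) (σ-fixed⇒ker y eq))))
        ... | no _   = 0≤* (0≤𝟙 (pow w y ≟ ε)) (0≤𝟙 (y ∈? D))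

      -- R / 3 is the value each of the nine fibres of `pow w` would receive if E were spread evenly
      -- over them, since Σ e = rn = 9 · (R / 3).
      R : ℤ
      R = + r * + M

      -- A variance estimate: of the nine squares (3Y - R)², with Y the number of elements of D in a
      -- coset of H, only the one for H itself is kept. The factor 3 clears the denominator of the
      -- mean.
      w-fibres : + 9 * (k₁ * k₁) + (- (+ 6 * R) * k₁ + R * R * 1ℤ)
                 ≤ + 9 * (+ w * μ + β * k₁ + (k - μ)) + (- (+ 6 * R) * k + R * R * + 9)
      w-fibres = subst₂ _≤_ (cong (λ t → + 9 * (k₁ * k₁) + (- (+ 6 * R) * k₁ + R * R * t)) (𝟙-yes (pow 9 ε ≟ ε) (pow-ε 9)))
        total (sum-except ε (λ u → + 9 * (push w d u * push w d u) + (- (+ 6 * R) * push w d u + R * R * ker 9 u)) (λ u _ → nonneg u))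
        where
        open ≡ using (subst₂)
        nonneg : ∀ u → 0ℤ ≤ + 9 * (push w d u * push w d u) + (- (+ 6 * R) * push w d u + R * R * ker 9 u)
        -- `push w d` is supported on the 9-torsion, so inserting the factor `ker 9 u` makes the
        -- term a full square there and 0 elsewhere.
        nonneg u = subst (λ t → 0ℤ ≤ + 9 * (t * t) + (- (+ 6 * R) * t + R * R * ker 9 u))
          (push-ker {w} {9} v≡w9 d u) (case (pow 9 u ≟ ε))
          where
          square : ∀ z R → (+ 3 * z - R) * (+ 3 * z - R)
                   ≡ + 9 * (1ℤ * z * (1ℤ * z)) + (- (+ 6 * R) * (1ℤ * z) + R * R * 1ℤ)
          square = ℤ-Solver.solve-∀
          zero≡ : ∀ z R → 0ℤ ≡ + 9 * (0ℤ * z * (0ℤ * z)) + (- (+ 6 * R) * (0ℤ * z) + R * R * 0ℤ)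
          zero≡ = ℤ-Solver.solve-∀
          case : (u? : Dec (pow 9 u ≡ ε)) → 0ℤ ≤ + 9 * (𝟙 u? * push w d u * (𝟙 u? * push w d u))
                                               + (- (+ 6 * R) * (𝟙 u? * push w d u) + R * R * 𝟙 u?)
          case (yes _) = subst (0ℤ ≤_) (square (push w d u) R) (0≤i*i (+ 3 * push w d u - R))
          case (no _)  = ℤ.≤-reflexive (zero≡ (push w d u) R)
        total : sum (λ u → + 9 * (push w d u * push w d u) + (- (+ 6 * R) * push w d u + R * R * ker 9 u))
                ≡ + 9 * (+ w * μ + β * k₁ + (k - μ)) + (- (+ 6 * R) * k + R * R * + 9)
        total = ≡.trans (sum-quadratic (push w d) (push w d) (ker 9) (+ 9) (- (+ 6 * R)) (R * R))
          (cong₂ (λ s t → + 9 * s + t)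
            (≡.trans (second-moment w) (cong (λ t → t * μ + β * k₁ + (k - μ)) ∣kerw∣))
            (cong₂ (λ s t → - (+ 6 * R) * s + R * R * t) (≡.trans (sum-push-1 w d) sum-d) ∣ker9∣))

      +n≡ : + n ≡ + 3 * + M
      +n≡ = ≡.trans (cong +_ n≡3M) (ℤ.pos-* 3 M)

      n<2r+4 : 1 ℕ.≤ r → ¬ (4 ℕ.+ 2 ℕ.* r ℕ.≤ n)
      n<2r+4 1≤r 2r+4≤n = moments-incompatible n r {x} {k₁} {sum d-fixed} {push 9 d-fixed ε} 1≤r 2r+4≤n
        (0≤push 9 (λ y → 0≤𝟙 (y ∈? D)) ε) (0≤push 9 0≤d-fixed ε) fixed≤k₁
        (identity-fibre-bound r M {+ n} {+ w} {k₁} +n≡ (ℤ.pos-* M M) w-fibres) 9-fibres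

-- Specialisation to the two families of orders

open import Data.Nat using (_+_; _*_; _^_; _≤_; _%_)
open import Data.Nat.GCD using (gcd; gcd-greatest)
open import Data.Product using (_×_)

prime-∣-^ : ∀ {p} → Prime p → ∀ m k → p ∣ m ^ k → p ∣ m
prime-∣-^ p-prime m zero    p∣1 = ℕ∣.∣-trans p∣1 (ℕ∣.1∣ m)
prime-∣-^ p-prime m (suc k) p∣  = [ id , prime-∣-^ p-prime m k ]′ (euclidsLemma m (m ^ k) p-prime p∣)

prime-∣-prime : ∀ {p q} → Prime p → Prime q → p ∣ q → p ≡ q
prime-∣-prime p-prime q-prime p∣q with prime⇒irreducible q-prime p∣q
... | inj₁ ≡.refl = contradiction p-prime ¬prime[1]
... | inj₂ p≡q    = p≡q

3∤⇒coprime-9-square : ∀ M → .{{NonZero M}} → ¬ (3 ∣ M) → Coprime 9 (M * M)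
3∤⇒coprime-9-square M 3∤M = no-common-prime⇒coprime {{ℕ.m*n≢0 M M}} no-prime
  where
  no-prime : ∀ {p} → Prime p → p ∣ 9 → ¬ (p ∣ M * M)
  no-prime p-prime p∣9 p∣M² with prime-∣-prime p-prime prime[3] (prime-∣-^ p-prime 3 2 p∣9)
  ... | ≡.refl = 3∤M (reduce (euclidsLemma M M p-prime p∣M²))

-- The order v is tied to M only by an equation, so the groups of both parts enter on their own
-- carriers, with M = m² and M = p^(2s).
negativeLatinSquare-9M² : ∀ {v M r} {_∙_ : Op₂ (Fin v)} {ε : Fin v} {_⁻¹ : Op₁ (Fin v)} → .{{NonZero M}} →
  v ≡ 9 * (M * M) → ¬ (2 ∣ M) → ¬ (3 ∣ M) → IsAbelianGroup _≡_ _∙_ ε _⁻¹ → (D : Subset v) →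
  1 ≤ r → IsNLSPDS _∙_ ε _⁻¹ D (3 * M) r → 2 * r + 1 ≤ 3 * M → (2 * r + 1 ≡ 3 * M) ⊎ (2 * r + 3 ≡ 3 * M)
negativeLatinSquare-9M² {v} {M} {r} v≡9M² 2∤M 3∤M isAbelianGroup D 1≤r isPDS 2r<n = cases (ℕ.m≤n⇒∃[o]m+o≡n 2r<n)
  where
  v≡n² : v ≡ 3 * M * (3 * M)
  v≡n² = ≡.trans v≡9M² (eq M)
    where
    eq : ∀ M → 9 * (M * M) ≡ 3 * M * (3 * M)
    eq = ℕ-Solver.solve-∀

  open Counting.NegativeLatinSquare isAbelianGroup D {3 * M} {r} isPDS v≡n² 2r<n
  9⊥M² : Coprime 9 (M * M)
  9⊥M² = 3∤⇒coprime-9-square M 3∤M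

  open Fibres ≡.refl 9⊥M² (proj₁ (reflecting-exponent 9⊥M²)) (proj₁ (proj₂ (reflecting-exponent 9⊥M²)))
    (proj₂ (proj₂ (reflecting-exponent 9⊥M²)))

  -- The slack i is n - (2r + 1), so i ≥ 3 is the range ruled out by the fibre inequalities.
  cases : (∃ λ i → 2 * r + 1 + i ≡ 3 * M) → (2 * r + 1 ≡ 3 * M) ⊎ (2 * r + 3 ≡ 3 * M)
  cases (0 , eq) = inj₁ (≡.trans (≡.sym (ℕ.+-identityʳ _)) eq)
  cases (1 , eq) = contradiction (ℕ∣.divides (r + 1) (≡.trans (≡.sym eq) (even r)))
    λ 2∣3M → [ (λ 2∣3 → contradiction (prime-∣-prime prime[2] prime[3] 2∣3) λ ()) , 2∤M ]′
               (euclidsLemma 3 M prime[2] 2∣3M)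
    where
    even : ∀ r → 2 * r + 1 + 1 ≡ (r + 1) * 2
    even = ℕ-Solver.solve-∀
  cases (2 , eq) = inj₂ (≡.trans (≡.sym (ℕ.+-assoc (2 * r) 1 2)) eq)
  cases (suc (suc (suc i)) , eq) = contradiction (subst (4 + 2 * r ≤_) (≡.trans (large r i) eq) (ℕ.m≤m+n _ i)) (n<2r+4 1≤r)
    where
    large : ∀ r i → 4 + 2 * r + i ≡ 2 * r + 1 + (3 + i)
    large = ℕ-Solver.solve-∀

9*square : ∀ m j k → k ≡ j + j → 9 * m ^ k ≡ 9 * (m ^ j * m ^ j)
9*square m j k ≡.refl = cong (9 *_) (ℕ.^-distribˡ-+-* m j j)

coprime-3⇒3∤ : ∀ {m} → gcd 3 m ≡ 1 → ¬ (3 ∣ m)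
coprime-3⇒3∤ gcd≡1 3∣m = contradiction (subst (3 ∣_) gcd≡1 (gcd-greatest ℕ∣.∣-refl 3∣m)) (from-no (3 ℕ∣.∣? 1))

-- Applied to q = 2 and q = 3, whose residues modulo 4 are 2 and 3: this is how p ≡ 1 (mod 4)
-- supplies the coprimality of p to 6.
∤-prime≡1-mod-4 : ∀ {q p} → Prime q → Prime p → q % 4 ≢ 1 → p % 4 ≡ 1 → ¬ (q ∣ p)
∤-prime≡1-mod-4 q-prime p-prime q%4≢1 p%4≡1 q∣p =
  q%4≢1 (≡.trans (cong (_% 4) (prime-∣-prime q-prime p-prime q∣p)) p%4≡1)

theorem8 : (∀ (m r : ℕ) → 1 ≤ m → ¬ (2 ∣ m) → gcd 3 m ≡ 1 →
    (_∙_ : Op₂ (Fin (9 * m ^ 4))) (ε : Fin (9 * m ^ 4)) (_⁻¹ : Op₁ (Fin (9 * m ^ 4))) →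
    IsAbelianGroup _≡_ _∙_ ε _⁻¹ →
    (D : Subset (9 * m ^ 4)) →
    1 ≤ r → IsNLSPDS _∙_ ε _⁻¹ D (3 * m ^ 2) r →
    2 * r + 1 ≤ 3 * m ^ 2 →
    (4 * r + 3 ≡ 3 * m ^ 2) ⊎ (4 * r ≡ 3 * m ^ 2 + 1) ⊎ (4 * r ≡ 3 * m ^ 2 + 5) ⊎
    (2 * r + 5 ≡ 3 * m ^ 2) ⊎ (2 * r + 3 ≡ 3 * m ^ 2) ⊎ (2 * r + 1 ≡ 3 * m ^ 2))
    ×
    (∀ (p s r : ℕ) → Prime p → p % 4 ≡ 1 → 1 ≤ s → ¬ (2 ∣ s) →
    (_∙_ : Op₂ (Fin (9 * p ^ (4 * s)))) (ε : Fin (9 * p ^ (4 * s)))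
    (_⁻¹ : Op₁ (Fin (9 * p ^ (4 * s)))) →
    IsAbelianGroup _≡_ _∙_ ε _⁻¹ →
    (D : Subset (9 * p ^ (4 * s))) →
    1 ≤ r → IsNLSPDS _∙_ ε _⁻¹ D (3 * p ^ (2 * s)) r →
    2 * r + 1 ≤ 3 * p ^ (2 * s) →
    (4 * r ≡ 3 * p ^ (2 * s) + 1) ⊎ (2 * r + 1 ≡ 3 * p ^ (2 * s)) ⊎ (2 * r + 3 ≡ 3 * p ^ (2 * s)))
theorem8 =
  (λ m r 1≤m 2∤m gcd≡1 _∙_ ε _⁻¹ isAbelianGroup D 1≤r isPDS 2r<n →
    [ inj₂ ∘ inj₂ ∘ inj₂ ∘ inj₂ ∘ inj₂ , inj₂ ∘ inj₂ ∘ inj₂ ∘ inj₂ ∘ inj₁ ]′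
      (negativeLatinSquare-9M² {M = m ^ 2} {r} {{ℕ.m^n≢0 m 2 {{ℕ.>-nonZero 1≤m}}}} (9*square m 2 4 ≡.refl)
        (2∤m ∘ prime-∣-^ prime[2] m 2) (coprime-3⇒3∤ gcd≡1 ∘ prime-∣-^ prime[3] m 2) isAbelianGroup D 1≤r isPDS 2r<n)) ,
  (λ p s r p-prime p%4≡1 1≤s 2∤s _∙_ ε _⁻¹ isAbelianGroup D 1≤r isPDS 2r<n →
    [ inj₂ ∘ inj₁ , inj₂ ∘ inj₂ ]′
      (negativeLatinSquare-9M² {M = p ^ (2 * s)} {r} {{ℕ.m^n≢0 p (2 * s) {{prime⇒nonZero p-prime}}}}
        (9*square p (2 * s) (4 * s) (ℕ.*-distribʳ-+ s 2 2))
        (∤-prime≡1-mod-4 prime[2] p-prime (λ ()) p%4≡1 ∘ prime-∣-^ prime[2] p (2 * s))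
        (∤-prime≡1-mod-4 prime[3] p-prime (λ ()) p%4≡1 ∘ prime-∣-^ prime[3] p (2 * s))
        isAbelianGroup D 1≤r isPDS 2r<n))
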